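{- Let $n\geq k$ be positive integers. There exist two orthogonal cyclic $k$-cycle decompositions of $K_{(2n+1)\times k}$ in each of the following cases: (1) $k\in\{3,7,9\}$ and $n\equiv 0,3\pmod 4$; (2) $k=5$ and $n\equiv 3\pmod 4$; (3) $k\in\{4,8\}$ and $n$ arbitrary; (4) $k=6$ and $n$ even.
   Context: $K_{q\times r}$ is the complete multipartite graph with $q$ parts, each of size $r$. A $k$-cycle decomposition of a graph $K$ is a set of subgraphs of $K$, each a cycle of length $k$, whose edge sets partition $E(K)$. It is cyclic if it admits a cyclic group of automorphisms (bijections of $V(K)$ leaving the decomposition invariant) acting sharply transitively on $V(K)$. Two cycle decompositions $\mathcal{D},\mathcal{D}'$ of the same simple graph are orthogonal if every $B\in\mathcal{D}$ and every $B'\in\mathcal{D}'$ have at most one edge in common. -}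

module Defs where

open import Data.Fin.Base using (Fin; toℕ)
open import Data.Integer.Base using (ℤ; +_; -[1+_])
open import Data.Nat.Base using (ℕ; zero; suc; _≤_)
open import Data.Nat.DivMod using (_mod_)
open import Data.Product using (_×_; ∃; ∃!; proj₁)
open import Data.Sum.Base using (_⊎_)
open import Function.Bundles using (_↔_; _⇔_; module Inverse)
open import Function.Definitions using (Injective)
open import Function.Properties.Inverse using (↔-refl; ↔-sym; ↔-trans)
open import Level using (0ℓ)
open import Relation.Binary.Core using (Rel)
open import Relation.Binary.Definitions using (Symmetric; _Respects_)
open import Relation.Binary.PropositionalEquality using (_≡_; _≢_; _≗_; refl; sym)
open import Relation.Nullary using (¬_)
open import Relation.Unary using (Pred; _∈_)

open Inverse using (to; from)

-- A simple graph whose vertex set is all of V.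
record SimpleGraph (V : Set) : Set₁ where
  field
    Adj       : Rel V 0ℓ
    symmetric : Symmetric Adj
    loopless  : ∀ {v} → ¬ Adj v v

-- A simple graph whose vertex set is a subset of V, i.e. a potential
-- subgraph of a SimpleGraph V.
record PartialGraph (V : Set) : Set₁ where
  field
    Vertex    : Pred V 0ℓ
    Adj       : Rel V 0ℓ
    symmetric : Symmetric Adj
    loopless  : ∀ {v} → ¬ Adj v v
    endpoint  : ∀ {u v} → Adj u v → Vertex u

K[_×_] : (q r : ℕ) → SimpleGraph (Fin q × Fin r)
K[ q × r ] = record
  { Adj       = λ u v → proj₁ u ≢ proj₁ v
  ; symmetric = λ u≢v v≡u → u≢v (sym v≡u)
  ; loopless  = λ v≢v → v≢v refl
  }

next : ∀ {k} → Fin k → Fin k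
next {suc m} i = suc (toℕ i) mod suc m

module _ {V : Set} where

  open PartialGraph

  infix 4 _⊑_ _≈_ _≈ₚ_

  -- G has all of V as vertex set, so only edges are constrained.
  _⊑_ : PartialGraph V → SimpleGraph V → Set
  H ⊑ G = ∀ {u v} → Adj H u v → SimpleGraph.Adj G u v

  _≈_ : PartialGraph V → PartialGraph V → Set
  H ≈ H′ = (∀ v → Vertex H v ⇔ Vertex H′ v) × (∀ u v → Adj H u v ⇔ Adj H′ u v)

  image : V ↔ V → PartialGraph V → PartialGraph V
  image g H = record
    { Vertex    = λ v → Vertex H (from g v)
    ; Adj       = λ u v → Adj H (from g u) (from g v)
    ; symmetric = symmetric H
    ; loopless  = loopless H
    ; endpoint  = endpoint H
    }

  -- Edges are unordered pairs: {u, v} = {u′, v′}.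
  SameEdge : (u v u′ v′ : V) → Set
  SameEdge u v u′ v′ = (u ≡ u′ × v ≡ v′) ⊎ (u ≡ v′ × v ≡ u′)

  IsCycle : ℕ → PartialGraph V → Set
  IsCycle k H = 3 ≤ k × ∃ λ (c : Fin k → V) →
    Injective _≡_ _≡_ c ×
    (∀ v → Vertex H v ⇔ ∃ λ i → c i ≡ v) ×
    (∀ u v → Adj H u v ⇔ ∃ λ i → SameEdge u v (c i) (c (next i)))

  -- A set of subgraphs is a predicate respecting equality of subgraphs.
  record IsCycleDecomposition (k : ℕ) (G : SimpleGraph V)
                              (𝒟 : Pred (PartialGraph V) 0ℓ) : Set₁ where
    field
      respects  : 𝒟 Respects _≈_
      subgraph  : ∀ {B} → B ∈ 𝒟 → B ⊑ G
      cycle     : ∀ {B} → B ∈ 𝒟 → IsCycle k B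
      partition : ∀ {u v} → SimpleGraph.Adj G u v →
                  ∃! _≈_ λ B → B ∈ 𝒟 × Adj B u v

  infixr 8 _^_
  _^_ : V ↔ V → ℤ → V ↔ V
  σ ^ (+ zero)     = ↔-refl
  σ ^ (+ suc n)    = ↔-trans (σ ^ (+ n)) σ
  σ ^ -[1+ zero ]  = ↔-sym σ
  σ ^ -[1+ suc n ] = ↔-trans (σ ^ -[1+ n ]) (↔-sym σ)

  _≈ₚ_ : Rel (V ↔ V) 0ℓ
  g ≈ₚ h = to g ≗ to h

  ⟨_⟩ : V ↔ V → Pred (V ↔ V) 0ℓ
  ⟨ σ ⟩ g = ∃ λ z → g ≈ₚ σ ^ z

  SharplyTransitive : Pred (V ↔ V) 0ℓ → Set
  SharplyTransitive 𝒢 = ∀ u v → ∃! _≈ₚ_ λ g → g ∈ 𝒢 × to g u ≡ v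

  IsAutomorphism : Pred (PartialGraph V) 0ℓ → V ↔ V → Set₁
  IsAutomorphism 𝒟 g = ∀ B → B ∈ 𝒟 ⇔ image g B ∈ 𝒟

  IsCyclic : Pred (PartialGraph V) 0ℓ → Set₁
  IsCyclic 𝒟 = ∃ λ σ → (∀ {g} → g ∈ ⟨ σ ⟩ → IsAutomorphism 𝒟 g) ×
                        SharplyTransitive ⟨ σ ⟩

  Orthogonal : Rel (Pred (PartialGraph V) 0ℓ) _
  Orthogonal 𝒟 𝒟′ = ∀ {B B′} → B ∈ 𝒟 → B′ ∈ 𝒟′ → ∀ {u v u′ v′} →
    Adj B u v → Adj B′ u v → Adj B u′ v′ → Adj B′ u′ v′ → SameEdge u v u′ v′

{-# OPTIONS --safe #-}

-- Let q = 2n + 1 and v = qk. Under x ↦ (x mod q, ⌊x / q⌋ mod k) the graph K[ q × k ] becomes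
-- the Cayley graph of ℤ/v whose connection set consists of the non-multiples of q. If the steps
-- of n base cycles hit every non-multiple of q modulo v up to sign, then they do so exactly once
-- by counting, so the translates of the base cycles form a cyclic decomposition 𝒟. Take 𝒟′ = -𝒟:
-- a cycle of 𝒟 and one of 𝒟′ sharing an edge are reflections of each other, and the reflection
-- fixes precisely the edges {x, y} with a given value of x + y. So 𝒟 and 𝒟′ are orthogonal once
-- x + y distinguishes the edges of each base cycle; for triangles it always does.
--
-- Base cycles. For k = 4, 8 the r-th cycle uses the steps ±(r + jq), j mod k. For k = 5, 7, 9 it
-- uses all of them but j = h = (k - 1) / 2, and closes with 2r + hq; as 2 is invertible modulo q,
-- these last steps replace the missing ones. For k = 6 the classes are paired. For k = 3 take
-- Bose's triangles if 3 ∤ q and Peltesohn's difference triples otherwise.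

module Submission where

open import Defs

-- A cycle with steps ±(r + jq), one for each j mod k, closes only if the signed sum of its steps
-- vanishes modulo kq. For r = 1 the signs add up to an integer of absolute value at most k < q,
-- which must therefore be 0. This is impossible for odd k, whence the step 2r there. For even k the
-- signed sum of the j must then be divisible by k, and its parity is that of k(k - 1)/2: even for k
-- = 4 and 8, odd for k = 6, whence the pairing of two classes.
--
-- Distinct values of x + y are a further demand: edges whose sums contain the same multiple of r
-- need sums of coefficients of q that differ modulo k. None of these demands involves n. As long as
-- r and 2r (for k = 6: r, s and r - s) are not multiples of q, the coefficients alone decide every
-- condition on a base cycle, so one evaluation serves all n.

module CyclicDecompositions where

  open import Data.Empty using (⊥-elim)
  open import Data.Fin.Base using (Fin; zero; suc; toℕ; fromℕ<; punchOut; combine; remQuot)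
  open import Data.Fin.Properties
    using (toℕ<n; toℕ-injective; toℕ-fromℕ<; any?; all?; punchOut-injective; <⇒notInjective; *↔×; +↔⊎;
           remQuot-combine; combine-remQuot; toℕ-combine)
    renaming (_≟_ to _≟ᶠ_)
  open import Data.Integer.Base as ℤ using (ℤ; +_; -[1+_]; _+_; _-_; _*_; -_; ∣_∣; 0ℤ; 1ℤ; -1ℤ)
  open import Data.Integer.Divisibility.Signed
  open import Data.Integer.DivMod using (_%ℕ_; _/ℕ_; n%ℕd<d; a≡a%ℕn+[a/ℕn]*n)
  import Data.Integer.Properties as ℤ
  open import Data.Integer.Tactic.RingSolver using (solve-∀)
  open import Data.List.Base as List using (List; _∷_; []; length; applyUpTo; _++_)
  import Data.List.Properties as List
  open import Data.List.Relation.Unary.All as All using (All; _∷_; [])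
  open import Data.List.Relation.Unary.Any as Any using (Any; here; there)
  import Data.List.Relation.Unary.Any.Properties as Any
  open import Data.Nat.Base as ℕ using (ℕ; NonZero)
  import Data.Nat.Divisibility as ℕ
  import Data.Nat.DivMod as ℕ
  import Data.Nat.Properties as ℕ
  import Data.Nat.Tactic.RingSolver as ℕ-Solver
  open import Data.Product using (_×_; _,_; ∃; ∃₂; ∃!; proj₁; proj₂)
  open import Data.Product.Function.NonDependent.Propositional using (_×-↔_)
  import Data.Product.Properties as ×
  open import Data.Sum.Base using (_⊎_; inj₁; inj₂; [_,_]′)
  open import Data.Sum.Function.Propositional using (_⊎-↔_)
  open import Data.Vec.Base using (lookup; _∷_; [])
  open import Function.Base using (_∘_; id)
  open import Function.Bundles using (_↔_; mk↔ₛ′; Inverse; _⇔_; mk⇔; Equivalence)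
  open import Function.Definitions using (Injective)
  open import Function.Properties.Equivalence using (⇔-isEquivalence)
  open import Function.Properties.Inverse using (↔-refl; ↔-sym; ↔-trans)
  open import Level using (0ℓ)
  open import Relation.Binary.Definitions using (DecidableEquality)
  open import Relation.Binary.PropositionalEquality
  open import Relation.Binary.Structures using (IsEquivalence)
  open import Relation.Nullary using (¬_; Dec; yes; no; contradiction)
  open import Relation.Nullary.Decidable using (True; _⊎-dec_; _×-dec_; ¬?; toWitness)
  open import Relation.Unary using (Pred; _∈_)

  -- Congruences and residues of integers.

  _∣-via_ : ∀ {m a b} → m ∣ a → a ≡ b → m ∣ b
  m∣a ∣-via refl = m∣a

  infix 4 _≡_[mod_]

  -- A record rather than an abbreviation of `m ∣ x - y`, so that unification recovers `x` and `y`;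
  -- it cannot do so through the subtraction.
  record _≡_[mod_] (x y m : ℤ) : Set where
    constructor congruent
    field difference : m ∣ x - y

  open _≡_[mod_] public

  module _ {m : ℤ} where

    ≡mod-refl : ∀ {x} → x ≡ x [mod m ]
    ≡mod-refl {x} = congruent (divides 0ℤ (ℤ.+-inverseʳ x))

    ≡mod-reflexive : ∀ {x y} → x ≡ y → x ≡ y [mod m ]
    ≡mod-reflexive refl = ≡mod-refl

    ≡mod-sym : ∀ {x y} → x ≡ y [mod m ] → y ≡ x [mod m ]
    ≡mod-sym {x} {y} (congruent p) = congruent (∣m⇒∣-m p ∣-via eq x y)
      where eq : ∀ x y → - (x - y) ≡ y - x
            eq = solve-∀

    ≡mod-trans : ∀ {x y z} → x ≡ y [mod m ] → y ≡ z [mod m ] → x ≡ z [mod m ]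
    ≡mod-trans {x} {y} {z} (congruent p) (congruent q) = congruent (∣m∣n⇒∣m+n p q ∣-via eq x y z)
      where eq : ∀ x y z → (x - y) + (y - z) ≡ x - z
            eq = solve-∀

    +-≡mod : ∀ {x x′ y y′} → x ≡ x′ [mod m ] → y ≡ y′ [mod m ] → x + y ≡ x′ + y′ [mod m ]
    +-≡mod {x} {x′} {y} {y′} (congruent p) (congruent q) = congruent (∣m∣n⇒∣m+n p q ∣-via eq x x′ y y′)
      where eq : ∀ x x′ y y′ → (x - x′) + (y - y′) ≡ x + y - (x′ + y′)
            eq = solve-∀

    -‿≡mod : ∀ {x y} → x ≡ y [mod m ] → - x ≡ - y [mod m ]
    -‿≡mod {x} {y} (congruent p) = congruent (∣m⇒∣-m p ∣-via eq x y)
      where eq : ∀ x y → - (x - y) ≡ - x - - y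
            eq = solve-∀

    +-cancelˡ-≡mod : ∀ a {x y} → a + x ≡ a + y [mod m ] → x ≡ y [mod m ]
    +-cancelˡ-≡mod a {x} {y} (congruent p) = congruent (p ∣-via eq a x y)
      where eq : ∀ a x y → a + x - (a + y) ≡ x - y
            eq = solve-∀

    ∣-resp-≡mod : ∀ {x y} → x ≡ y [mod m ] → m ∣ x → m ∣ y
    ∣-resp-≡mod {x} {y} (congruent p) m∣x = ∣m∣n⇒∣m-n m∣x p ∣-via eq x y
      where eq : ∀ x y → x - (x - y) ≡ y
            eq = solve-∀

  ∣m⊖n∣< : ∀ {m a b} → a ℕ.< m → b ℕ.< m → ∣ a ℤ.⊖ b ∣ ℕ.< m
  ∣m⊖n∣< {m} {a} {b} a<m b<m with ℕ.≤-total b a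
  ... | inj₁ b≤a = subst (ℕ._< m) (sym (cong ∣_∣ (ℤ.⊖-≥ b≤a))) (ℕ.≤-<-trans (ℕ.m∸n≤m a b) a<m)
  ... | inj₂ a≤b = subst (ℕ._< m) (sym (trans (cong ∣_∣ (ℤ.⊖-≤ a≤b)) (ℤ.∣-i∣≡∣i∣ (+ (b ℕ.∸ a)))))
                                  (ℕ.≤-<-trans (ℕ.m∸n≤m b a) b<m)

  toℕ-≡mod⇒≡ : ∀ {m} {i j : Fin m} → + toℕ i ≡ + toℕ j [mod + m ] → i ≡ j
  toℕ-≡mod⇒≡ {m} {i} {j} (congruent p) with ∣ + toℕ i - + toℕ j ∣ in eq
  ... | ℕ.zero = toℕ-injective (ℤ.+-injective (ℤ.i-j≡0⇒i≡j _ _ (ℤ.∣i∣≡0⇒i≡0 eq)))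
  ... | ℕ.suc d = contradiction (∣⇒∣ᵤ p) (ℕ.>⇒∤ {{ℕ.≢-nonZero λ z → ℕ.0≢1+n (trans (sym z) eq)}} bound)
    where
    bound : ∣ + toℕ i - + toℕ j ∣ ℕ.< m
    bound = subst (ℕ._< m) (cong ∣_∣ (sym (ℤ.m-n≡m⊖n (toℕ i) (toℕ j)))) (∣m⊖n∣< (toℕ<n i) (toℕ<n j))

  abstract

    residue : ∀ m .{{_ : NonZero m}} → ℤ → Fin m
    residue m x = fromℕ< (n%ℕd<d x m)

    toℕ-residue : ∀ m .{{_ : NonZero m}} x → toℕ (residue m x) ≡ x %ℕ m
    toℕ-residue m x = toℕ-fromℕ< (n%ℕd<d x m)

  residue-≡mod : ∀ m .{{_ : NonZero m}} x → x ≡ + toℕ (residue m x) [mod + m ]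
  residue-≡mod m x = congruent (divides (x /ℕ m) (trans
    (cong₂ (λ a b → a - + b) (a≡a%ℕn+[a/ℕn]*n x m) (toℕ-residue m x))
    (eq (+ (x %ℕ m)) (x /ℕ m * + m))))
    where eq : ∀ a b → a + b - a ≡ b
          eq = solve-∀

  residue-cong : ∀ m .{{_ : NonZero m}} {x y} → x ≡ y [mod + m ] → residue m x ≡ residue m y
  residue-cong m {x} {y} p = toℕ-≡mod⇒≡ (≡mod-trans (≡mod-sym (residue-≡mod m x)) (≡mod-trans p (residue-≡mod m y)))

  residue-injective : ∀ m .{{_ : NonZero m}} {x y} → residue m x ≡ residue m y → x ≡ y [mod + m ]
  residue-injective m {x} {y} p = ≡mod-trans (residue-≡mod m x)
    (≡mod-trans (≡mod-reflexive (cong (+_ ∘ toℕ) p)) (≡mod-sym (residue-≡mod m y)))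

  -- A residue at most n is kept. A larger one is replaced by minus its complement in 2n + 1, which
  -- is then at most n. An index `d` stands for the value d + 1, as it does for the classes r later
  -- on.
  ±residue : ∀ n .{{_ : NonZero (2 ℕ.* n ℕ.+ 1)}} x → ¬ + (2 ℕ.* n ℕ.+ 1) ∣ x →
    ∃ λ (d : Fin n) → x ≡ + ℕ.suc (toℕ d) [mod + (2 ℕ.* n ℕ.+ 1) ] ⊎ x ≡ - + ℕ.suc (toℕ d) [mod + (2 ℕ.* n ℕ.+ 1) ]
  ±residue n x q∤x with toℕ (residue (2 ℕ.* n ℕ.+ 1) x) in eq | residue-≡mod (2 ℕ.* n ℕ.+ 1) x | toℕ<n (residue (2 ℕ.* n ℕ.+ 1) x)
  ... | ℕ.zero  | p | _ = contradiction (difference p ∣-via ℤ.+-identityʳ x) q∤x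
  ... | ℕ.suc e | p | e<q with e ℕ.<? n
  ...   | yes e<n = fromℕ< e<n , inj₁ (subst (λ e → x ≡ + ℕ.suc e [mod _ ]) (sym (toℕ-fromℕ< e<n)) p)
  ...   | no  e≮n = fromℕ< d<n , inj₂ (subst (λ e → x ≡ - + ℕ.suc e [mod _ ]) (sym (toℕ-fromℕ< d<n))
          (≡mod-trans p (congruent (divides 1ℤ e+1+d+1≡q))))
    where
    q = 2 ℕ.* n ℕ.+ 1
    d = q ℕ.∸ ℕ.suc (ℕ.suc e)
    sum : ℕ.suc e ℕ.+ ℕ.suc d ≡ q
    sum = trans (ℕ.+-suc (ℕ.suc e) d) (ℕ.m+[n∸m]≡n e<q)
    d<n : d ℕ.< n
    d<n = ℕ.+-cancelˡ-≤ (ℕ.suc e) (ℕ.suc d) n (begin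
      ℕ.suc e ℕ.+ ℕ.suc d ≡⟨ sum ⟩
      n ℕ.+ (n ℕ.+ 0) ℕ.+ 1 ≡⟨ ℕ.+-comm (n ℕ.+ (n ℕ.+ 0)) 1 ⟩
      ℕ.suc (n ℕ.+ (n ℕ.+ 0)) ≡⟨ cong (λ z → ℕ.suc (n ℕ.+ z)) (ℕ.+-identityʳ n) ⟩
      ℕ.suc n ℕ.+ n ≤⟨ ℕ.+-monoˡ-≤ n (ℕ.s≤s (ℕ.≮⇒≥ e≮n)) ⟩
      ℕ.suc e ℕ.+ n ∎)
      where open ℕ.≤-Reasoning
    e+1+d+1≡q : + ℕ.suc e - - + ℕ.suc d ≡ 1ℤ * + q
    e+1+d+1≡q = trans (cong (λ z → + ℕ.suc e + z) (ℤ.neg-involutive (+ ℕ.suc d))) (trans (cong +_ sum) (sym (ℤ.*-identityˡ (+ q))))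

  -- Counting in finite types.

  injective⇒surjective : ∀ {N} {g : Fin N → Fin N} → Injective _≡_ _≡_ g → ∀ y → ∃ λ x → g x ≡ y
  injective⇒surjective {ℕ.suc N} {g} g-inj y with any? (λ x → g x ≟ᶠ y)
  ... | yes hit = hit
  ... | no miss = ⊥-elim (<⇒notInjective {f = λ i → punchOut (miss′ i)} (ℕ.n<1+n N)
    λ {i} {j} eq → g-inj (punchOut-injective (miss′ i) (miss′ j) eq))
    where
    miss′ : ∀ x → y ≢ g x
    miss′ x eq = miss (x , sym eq)

  -- A section `g` of `f` is injective. Between types of equal finite size it is then surjective,
  -- which makes `f` its two-sided inverse.
  surjective⇒injective : ∀ {A B : Set} {N} → A ↔ Fin N → B ↔ Fin N →
    (f : A → B) → (∀ y → ∃ λ x → f x ≡ y) → ∀ {x x′} → f x ≡ f x′ → x ≡ x′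
  surjective⇒injective A↔N B↔N f f-sur {x} {x′} fx≡fx′ =
    trans (sym (proj₂ (g-sur x))) (trans (cong g (trans (f∘g⁻¹ x) (trans fx≡fx′ (sym (f∘g⁻¹ x′))))) (proj₂ (g-sur x′)))
    where
    module A = Inverse A↔N
    module B = Inverse B↔N
    g = λ y → proj₁ (f-sur y)
    f∘g : ∀ y → f (g y) ≡ y
    f∘g y = proj₂ (f-sur y)
    ĝ = λ i → A.to (g (B.from i))
    ĝ-inj : Injective _≡_ _≡_ ĝ
    ĝ-inj {i} {j} eq = trans (sym (B.strictlyInverseˡ i)) (trans (cong B.to fgi≡fgj) (B.strictlyInverseˡ j))
      where
      gi≡gj = trans (sym (A.strictlyInverseʳ (g (B.from i)))) (trans (cong A.from eq) (A.strictlyInverseʳ (g (B.from j))))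
      fgi≡fgj = trans (sym (f∘g (B.from i))) (trans (cong f gi≡gj) (f∘g (B.from j)))
    g-sur : ∀ x → ∃ λ y → g y ≡ x
    g-sur x with i , eq ← injective⇒surjective ĝ-inj (A.to x) =
      B.from i , trans (sym (A.strictlyInverseʳ (g (B.from i)))) (trans (cong A.from eq) (A.strictlyInverseʳ x))
    f∘g⁻¹ : ∀ x → proj₁ (g-sur x) ≡ f x
    f∘g⁻¹ x = trans (sym (f∘g (proj₁ (g-sur x)))) (cong f (proj₂ (g-sur x)))

  -- The vertices as the cyclic group of order qk.

  -- The cyclic group ℤ/qk acts on the vertices of K[ q × k ] through point:
  -- the part of point x is the residue of x modulo q.
  module Points (q k : ℕ) .{{_ : NonZero q}} .{{_ : NonZero k}} where

    V : Set
    V = Fin q × Fin k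

    v : ℤ
    v = + q * + k

    q∣v : + q ∣ v
    q∣v = ∣m⇒∣m*n (+ k) ∣-refl

    abstract
      point : ℤ → V
      point x = residue q x , residue k (x /ℕ q)

      index : V → ℤ
      index (a , b) = + toℕ a + + toℕ b * + q

      ∣-cancel : ∀ a b b′ → v ∣ a + b * + q - (a + b′ * + q) → + k ∣ b - b′
      ∣-cancel a b b′ p = *-cancelˡ-∣ (+ q) {+ k} {b - b′} {{ℕ.≢-nonZero (ℕ.≢-nonZero⁻¹ q)}} (p ∣-via eq a b b′ (+ q))
        where
        eq : ∀ a b b′ q → a + b * q - (a + b′ * q) ≡ q * (b - b′)
        eq = solve-∀

      index-≡modq : ∀ u → index u ≡ + toℕ (proj₁ u) [mod + q ]
      index-≡modq (a , b) = congruent (divides (+ toℕ b) (eq (+ toℕ a) (+ toℕ b * + q)))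
        where eq : ∀ a bq → a + bq - a ≡ bq
              eq = solve-∀

      index-injective : ∀ {u w} → index u ≡ index w [mod v ] → u ≡ w
      index-injective {u} {w} p = cong₂ _,_ part≡ (toℕ-≡mod⇒≡ offset≡)
        where
        part≡ : proj₁ u ≡ proj₁ w
        part≡ = toℕ-≡mod⇒≡ (≡mod-trans (≡mod-sym (index-≡modq u)) (≡mod-trans (congruent (∣-trans q∣v (difference p))) (index-≡modq w)))
        offset≡ : + toℕ (proj₂ u) ≡ + toℕ (proj₂ w) [mod + k ]
        offset≡ = congruent (∣-cancel (+ toℕ (proj₁ w)) (+ toℕ (proj₂ u)) (+ toℕ (proj₂ w))
          (subst (λ a → v ∣ + toℕ a + + toℕ (proj₂ u) * + q - index w) part≡ (difference p)))

      *q-≡mod : ∀ r {y b} → y ≡ b [mod + k ] → r + y * + q ≡ r + b * + q [mod v ]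
      *q-≡mod r {y} {b} (congruent (divides t y-b≡tk)) = congruent (divides t (begin
        r + y * + q - (r + b * + q)  ≡⟨ eq₁ r y b (+ q) ⟩
        (y - b) * + q                ≡⟨ cong (_* + q) y-b≡tk ⟩
        t * + k * + q                ≡⟨ eq₂ t (+ k) (+ q) ⟩
        t * v                        ∎))
        where
        open ≡-Reasoning
        eq₁ : ∀ r y b q → r + y * q - (r + b * q) ≡ (y - b) * q
        eq₁ = solve-∀
        eq₂ : ∀ t k q → t * k * q ≡ t * (q * k)
        eq₂ = solve-∀

      index-point : ∀ x → x ≡ index (point x) [mod v ]
      index-point x = ≡mod-trans (≡mod-reflexive x≡) (*q-≡mod (+ toℕ (residue q x)) (residue-≡mod k (x /ℕ q)))
        where
        x≡ : x ≡ + toℕ (residue q x) + x /ℕ q * + q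
        x≡ = trans (a≡a%ℕn+[a/ℕn]*n x q) (cong (λ r → + r + x /ℕ q * + q) (sym (toℕ-residue q x)))

      part-point : ∀ x → proj₁ (point x) ≡ residue q x
      part-point x = refl

    point-index : ∀ u → point (index u) ≡ u
    point-index u = index-injective (≡mod-sym (index-point (index u)))

    point-cong : ∀ {x y} → x ≡ y [mod v ] → point x ≡ point y
    point-cong {x} {y} p = index-injective (≡mod-trans (≡mod-sym (index-point x)) (≡mod-trans p (index-point y)))

    point-injective : ∀ {x y} → point x ≡ point y → x ≡ y [mod v ]
    point-injective {x} {y} p = ≡mod-trans (index-point x) (≡mod-trans (≡mod-reflexive (cong index p)) (≡mod-sym (index-point y)))

    -- All that is ever used about a power of `σ`. It turns statements about composites of
    -- bijections, including sharp transitivity and invariance of the decomposition, into arithmetic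
    -- modulo `v`.
    ShiftsBy : V ↔ V → ℤ → Set
    ShiftsBy g z = ∀ x → Inverse.to g (point x) ≡ point (x + z)

    abstract

      rotation : ℤ → V ↔ V
      rotation g = mk↔ₛ′ (λ u → point (index u + g)) (λ u → point (index u - g))
        (λ u → inverse u (- g) g (eq₁ (index u) g))
        (λ u → inverse u g (- g) (eq₂ (index u) g))
        where
        eq₁ : ∀ x g → x - g + g ≡ x
        eq₁ = solve-∀
        eq₂ : ∀ x g → x + g - g ≡ x
        eq₂ = solve-∀
        inverse : ∀ u g h → index u + g + h ≡ index u → point (index (point (index u + g)) + h) ≡ u
        inverse u g h eq = trans
          (point-cong (≡mod-trans (+-≡mod (≡mod-sym (index-point (index u + g))) (≡mod-refl {x = h})) (≡mod-reflexive eq)))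
          (point-index u)

      rotation-shifts : ∀ z → ShiftsBy (rotation z) z
      rotation-shifts z x = point-cong (+-≡mod (≡mod-sym (index-point x)) ≡mod-refl)

    σ : V ↔ V
    σ = rotation 1ℤ

    ↔-sym-shifts : ∀ {g z} → ShiftsBy g z → ShiftsBy (↔-sym g) (- z)
    ↔-sym-shifts {g} {z} g-shifts x = begin
      Inverse.from g (point x)                       ≡⟨ cong (Inverse.from g ∘ point) (eq x z) ⟨
      Inverse.from g (point (x - z + z))             ≡⟨ cong (Inverse.from g) (g-shifts (x - z)) ⟨
      Inverse.from g (Inverse.to g (point (x - z)))  ≡⟨ Inverse.strictlyInverseʳ g _ ⟩
      point (x - z)                                  ∎
      where
      open ≡-Reasoning
      eq : ∀ x z → x - z + z ≡ x
      eq = solve-∀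

    ↔-trans-shifts : ∀ {g h y z} → ShiftsBy g y → ShiftsBy h z → ShiftsBy (↔-trans g h) (y + z)
    ↔-trans-shifts {g} {h} {y} {z} g-shifts h-shifts x =
      trans (cong (Inverse.to h) (g-shifts x)) (trans (h-shifts (x + y)) (cong point (ℤ.+-assoc x y z)))

    shifts-cong : ∀ {g y z} → y ≡ z → ShiftsBy g y → ShiftsBy g z
    shifts-cong refl g-shifts = g-shifts

    σ^-shifts : ∀ z → ShiftsBy (σ ^ z) z
    σ^-shifts (+ ℕ.zero)          x = cong point (sym (ℤ.+-identityʳ x))
    σ^-shifts (+ ℕ.suc m)         = shifts-cong {σ ^ (+ ℕ.suc m)} (cong +_ (ℕ.+-comm m 1))
      (↔-trans-shifts {σ ^ (+ m)} {σ} (σ^-shifts (+ m)) (rotation-shifts 1ℤ))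
    σ^-shifts -[1+ ℕ.zero ]       = ↔-sym-shifts {σ} (rotation-shifts 1ℤ)
    σ^-shifts -[1+ ℕ.suc m ]      = shifts-cong {σ ^ -[1+ ℕ.suc m ]} (cong (λ m → -[1+ ℕ.suc m ]) (ℕ.+-identityʳ m))
      (↔-trans-shifts {σ ^ -[1+ m ]} {↔-sym σ} (σ^-shifts -[1+ m ]) (↔-sym-shifts {σ} (rotation-shifts 1ℤ)))

    ⟨σ⟩-shifts : ∀ {g} → g ∈ ⟨ σ ⟩ → ∃ (ShiftsBy g)
    ⟨σ⟩-shifts (z , g≈σ^z) = z , λ x → trans (g≈σ^z (point x)) (σ^-shifts z x)

    shifts⇒to : ∀ {g z} → ShiftsBy g z → ∀ u → Inverse.to g u ≡ point (index u + z)
    shifts⇒to {g} g-shifts u = trans (cong (Inverse.to g) (sym (point-index u))) (g-shifts (index u))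

    shifts-moves : ∀ {g u w z} → ShiftsBy g z → index u + z ≡ index w [mod v ] → Inverse.to g u ≡ w
    shifts-moves {g} {u} {w} g-shifts p = trans (shifts⇒to {g} g-shifts u) (trans (point-cong p) (point-index w))

    shifts-unique : ∀ {g h u y z} → ShiftsBy g y → ShiftsBy h z → Inverse.to g u ≡ Inverse.to h u → y ≡ z [mod v ]
    shifts-unique {g} {h} {u} g-shifts h-shifts gu≡hu = +-cancelˡ-≡mod (index u) (point-injective
      (trans (sym (shifts⇒to {g} g-shifts u)) (trans gu≡hu (shifts⇒to {h} h-shifts u))))

    shifts-≈ₚ : ∀ {g h y z} → ShiftsBy g y → ShiftsBy h z → y ≡ z [mod v ] → g ≈ₚ h
    shifts-≈ₚ {g} {h} g-shifts h-shifts y≡z u = trans (shifts⇒to {g} g-shifts u)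
      (trans (point-cong (+-≡mod (≡mod-refl {x = index u}) y≡z)) (sym (shifts⇒to {h} h-shifts u)))

    -- The image of a single vertex determines the amount of a translation modulo `v`, hence the
    -- whole bijection.
    ⟨σ⟩-sharplyTransitive : SharplyTransitive ⟨ σ ⟩
    ⟨σ⟩-sharplyTransitive u w = sharp (index w - index u) (≡mod-reflexive (eq (index u) (index w)))
      where
      eq : ∀ x y → x + (y - x) ≡ y
      eq = solve-∀
      sharp : ∀ z → index u + z ≡ index w [mod v ] → ∃! _≈ₚ_ λ g → g ∈ ⟨ σ ⟩ × Inverse.to g u ≡ w
      sharp z p = σ ^ z , ((z , λ _ → refl) , σ^zu≡w) , λ {g} (g∈⟨σ⟩ , gu≡w) →
        let y , g-shifts = ⟨σ⟩-shifts {g} g∈⟨σ⟩ in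
        shifts-≈ₚ {σ ^ z} {g} (σ^-shifts z) g-shifts
          (shifts-unique {σ ^ z} {g} {u} (σ^-shifts z) g-shifts (trans σ^zu≡w (sym gu≡w)))
        where
        σ^zu≡w : Inverse.to (σ ^ z) u ≡ w
        σ^zu≡w = shifts-moves {σ ^ z} (σ^-shifts z) p

  -- Equality of subgraphs, and the graph of a closed walk.

  module _ {V : Set} where

    ≈-refl : (B : PartialGraph V) → B ≈ B
    ≈-refl _ = (λ _ → ⇔.refl) , λ _ _ → ⇔.refl
      where module ⇔ = IsEquivalence ⇔-isEquivalence

    ≈-sym : (B B′ : PartialGraph V) → B ≈ B′ → B′ ≈ B
    ≈-sym _ _ (vs , es) = (λ u → ⇔.sym (vs u)) , λ u w → ⇔.sym (es u w)
      where module ⇔ = IsEquivalence ⇔-isEquivalence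

    ≈-trans : (B B′ B″ : PartialGraph V) → B ≈ B′ → B′ ≈ B″ → B ≈ B″
    ≈-trans _ _ _ (vs , es) (vs′ , es′) = (λ u → ⇔.trans (vs u) (vs′ u)) , λ u w → ⇔.trans (es u w) (es′ u w)
      where module ⇔ = IsEquivalence ⇔-isEquivalence

    sameEdge-swap : ∀ {u w x y : V} → SameEdge u w x y → SameEdge w u x y
    sameEdge-swap (inj₁ (p , q)) = inj₂ (q , p)
    sameEdge-swap (inj₂ (p , q)) = inj₁ (q , p)

    sameEdge-join : ∀ {u w u′ w′ x y : V} → SameEdge u w x y → SameEdge u′ w′ x y → SameEdge u w u′ w′
    sameEdge-join (inj₁ (refl , refl)) (inj₁ (refl , refl)) = inj₁ (refl , refl)
    sameEdge-join (inj₁ (refl , refl)) (inj₂ (refl , refl)) = inj₂ (refl , refl)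
    sameEdge-join (inj₂ (refl , refl)) (inj₁ (refl , refl)) = inj₂ (refl , refl)
    sameEdge-join (inj₂ (refl , refl)) (inj₂ (refl , refl)) = inj₁ (refl , refl)

    sameEdge-meet : ∀ {u w x y x′ y′ : V} → SameEdge u w x y → SameEdge u w x′ y′ → SameEdge x y x′ y′
    sameEdge-meet (inj₁ (refl , refl)) e = e
    sameEdge-meet (inj₂ (refl , refl)) e = sameEdge-swap e

    module _ {k} (w : Fin k → V) (w-loopless : ∀ i → w i ≢ w (next i)) where

      cycleGraph : PartialGraph V
      cycleGraph = record
        { Vertex    = λ u → ∃ λ i → w i ≡ u
        ; Adj       = λ u u′ → ∃ λ i → SameEdge u u′ (w i) (w (next i))
        ; symmetric = λ (i , e) → i , sameEdge-swap e
        ; loopless  = λ { (i , inj₁ (p , q)) → w-loopless i (trans (sym p) q)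
                        ; (i , inj₂ (p , q)) → w-loopless i (trans (sym q) p) }
        ; endpoint  = λ { (i , inj₁ (p , _)) → i , sym p
                        ; (i , inj₂ (p , _)) → next i , sym p }
        }

    cycleGraph-cong : ∀ {k} {w w′ : Fin k → V} l l′ → (∀ i → w i ≡ w′ i) → cycleGraph w l ≈ cycleGraph w′ l′
    cycleGraph-cong {w = w} {w′} _ _ eq =
      (λ u → mk⇔ (λ (i , p) → i , trans (sym (eq i)) p) (λ (i , p) → i , trans (eq i) p)) ,
      (λ u u′ → mk⇔ (λ (i , e) → i , subst₂ (SameEdge u u′) (eq i) (eq (next i)) e)
                    (λ (i , e) → i , subst₂ (SameEdge u u′) (sym (eq i)) (sym (eq (next i))) e))

  module _ {m : ℤ} where

    ≡mod-differences : ∀ {a a′ b b′ g g′} → a + g ≡ a′ + g′ [mod m ] → b + g ≡ b′ + g′ [mod m ] → b - a ≡ b′ - a′ [mod m ]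
    ≡mod-differences {a} {a′} {b} {b′} {g} {g′} (congruent p) (congruent q) = congruent (∣m∣n⇒∣m-n q p ∣-via eq a a′ b b′ g g′)
      where eq : ∀ a a′ b b′ g g′ → (b + g - (b′ + g′)) - (a + g - (a′ + g′)) ≡ b - a - (b′ - a′)
            eq = solve-∀

    ≡mod-neg-difference : ∀ {x y z} → x ≡ y - z [mod m ] → x ≡ - (z - y) [mod m ]
    ≡mod-neg-difference {x} {y} {z} p = ≡mod-trans p (≡mod-reflexive (eq y z))
      where eq : ∀ y z → y - z ≡ - (z - y)
            eq = solve-∀

  -- Base cycles and the counting of their differences.

  module CyclicSystem (n k : ℕ) .{{_ : NonZero (2 ℕ.* n ℕ.+ 1)}} .{{_ : NonZero k}} where

    q : ℕ
    q = 2 ℕ.* n ℕ.+ 1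

    open Points q k public

    step midpoint : (Fin k → ℤ) → Fin k → ℤ
    step c i = c (next i) - c i
    midpoint c i = c i + c (next i)

    Hits : (Fin k → ℤ) → ℤ → Set
    Hits c δ = ∃ λ i → δ ≡ step c i [mod v ] ⊎ δ ≡ - step c i [mod v ]

    Covers : (Fin n → Fin k → ℤ) → Set
    Covers c = ∀ δ → ¬ + q ∣ δ → ∃ λ r → Hits (c r) δ

    -- midpoint records twice the centre of the reflection that fixes an edge, so
    -- that midpoints-distinct says that no reflected translate of c r shares two
    -- edges with c r.
    record BaseCycles (c : Fin n → Fin k → ℤ) : Set where
      field
        vertices-distinct  : ∀ r {i j} → c r i ≡ c r j [mod v ] → i ≡ j
        midpoints-distinct : ∀ r {i j} → midpoint (c r) i ≡ midpoint (c r) j [mod v ] → i ≡ j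
        covers             : Covers c

    -- The 2nk signed steps and the k multiples of q together hit all (2n + 1)k
    -- residues, hence hit each of them once.
    module Counting {c : Fin n → Fin k → ℤ} (covers : Covers c) where

      Label : Set
      Label = (Fin n × Fin k × Fin 2) ⊎ Fin k

      difference-of : Label → V
      difference-of (inj₁ (r , i , zero))     = point (step (c r) i)
      difference-of (inj₁ (r , i , suc zero)) = point (- step (c r) i)
      difference-of (inj₂ j)                  = point (+ toℕ j * + q)

      ∣⇒multiple : ∀ {x} → + q ∣ x → ∃ λ j → difference-of (inj₂ j) ≡ point x
      ∣⇒multiple {x} (divides t x≡tq) = residue k t , point-cong (≡mod-sym (≡mod-trans
        (≡mod-reflexive (trans x≡tq (sym (ℤ.+-identityˡ (t * + q)))))
        (≡mod-trans (*q-≡mod 0ℤ (residue-≡mod k t)) (≡mod-reflexive (ℤ.+-identityˡ (+ toℕ (residue k t) * + q))))))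

      difference-of-surjective : ∀ u → ∃ λ l → difference-of l ≡ u
      difference-of-surjective u with + q ∣? index u
      ... | yes q∣u = let j , p = ∣⇒multiple q∣u in inj₂ j , trans p (point-index u)
      ... | no q∤u with covers (index u) q∤u
      ...   | r , i , inj₁ p = inj₁ (r , i , zero) , trans (point-cong (≡mod-sym p)) (point-index u)
      ...   | r , i , inj₂ p = inj₁ (r , i , suc zero) , trans (point-cong (≡mod-sym p)) (point-index u)

      difference-of-injective : ∀ {l l′} → difference-of l ≡ difference-of l′ → l ≡ l′
      difference-of-injective = surjective⇒injective
        (subst (λ N → Label ↔ Fin N) (eq n k) (↔-trans ((↔-refl ×-↔ ↔-sym *↔×) ⊎-↔ ↔-refl) (↔-trans (↔-sym *↔× ⊎-↔ ↔-refl) (↔-sym +↔⊎))))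
        (↔-sym *↔×) difference-of difference-of-surjective
        where
        eq : ∀ n k → n ℕ.* (k ℕ.* 2) ℕ.+ k ≡ (2 ℕ.* n ℕ.+ 1) ℕ.* k
        eq = ℕ-Solver.solve-∀

      -- Excludes that two translates run through a common edge in opposite directions, and that a
      -- translate and a reflected translate run through one in the same direction.
      step≢-step : ∀ {r i r′ i′} → ¬ step (c r) i ≡ - step (c r′) i′ [mod v ]
      step≢-step {r} {i} {r′} {i′} p =
        opposite (difference-of-injective {inj₁ (r , i , zero)} {inj₁ (r′ , i′ , suc zero)} (point-cong p))
        where
        opposite : _≢_ {A = Label} (inj₁ (r , i , zero)) (inj₁ (r′ , i′ , suc zero))
        opposite ()

      step-injective : ∀ {r i r′ i′} → step (c r) i ≡ step (c r′) i′ [mod v ] → (r , i) ≡ (r′ , i′)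
      step-injective {r} {i} {r′} {i′} p =
        unsigned (difference-of-injective {inj₁ (r , i , zero)} {inj₁ (r′ , i′ , zero)} (point-cong p))
        where
        unsigned : _≡_ {A = Label} (inj₁ (r , i , zero)) (inj₁ (r′ , i′ , zero)) → (r , i) ≡ (r′ , i′)
        unsigned refl = refl

      q∤step : ∀ r i → ¬ + q ∣ step (c r) i
      q∤step r i q∣step = let j , p = ∣⇒multiple q∣step in
        distinct (difference-of-injective {inj₂ j} {inj₁ (r , i , zero)} p)
        where
        distinct : ∀ {j} → _≢_ {A = Label} (inj₂ j) (inj₁ (r , i , zero))
        distinct ()

  -- The translates of base cycles form a cyclic decomposition.

  module Develop (n k : ℕ) .{{_ : NonZero (2 ℕ.* n ℕ.+ 1)}} .{{_ : NonZero k}} (3≤k : 3 ℕ.≤ k) where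

    open CyclicSystem n k

    same-part : ∀ x y → proj₁ (point x) ≡ proj₁ (point y) → + q ∣ y - x
    same-part x y p = difference (≡mod-sym (residue-injective q (trans (sym (part-point x)) (trans p (part-point y)))))

    point-sameEdge : ∀ {a b a′ b′} → SameEdge (point a) (point b) (point a′) (point b′) →
      (a ≡ a′ [mod v ] × b ≡ b′ [mod v ]) ⊎ (a ≡ b′ [mod v ] × b ≡ a′ [mod v ])
    point-sameEdge (inj₁ (p , p′)) = inj₁ (point-injective p , point-injective p′)
    point-sameEdge (inj₂ (p , p′)) = inj₂ (point-injective p , point-injective p′)

    +-swap-≡mod : ∀ {a b g h} → a + g ≡ - b + h [mod v ] → a + b ≡ h - g [mod v ]
    +-swap-≡mod {a} {b} {g} {h} (congruent p) = congruent (p ∣-via eq a b g h)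
      where eq : ∀ a b g h → a + g - (- b + h) ≡ a + b - (h - g)
            eq = solve-∀

    module Translates {c : Fin n → Fin k → ℤ} (base : BaseCycles c) where

      open BaseCycles base
      open Counting {c} covers

      vertex : Fin n → ℤ → Fin k → V
      vertex r g i = point (c r i + g)

      vertex-loopless : ∀ r g i → proj₁ (vertex r g i) ≢ proj₁ (vertex r g (next i))
      vertex-loopless r g i p = q∤step r i (same-part (c r i + g) (c r (next i) + g) p ∣-via eq (c r i) (c r (next i)) g)
        where eq : ∀ a b g → b + g - (a + g) ≡ b - a
              eq = solve-∀

      vertices-≢ : ∀ r g i → vertex r g i ≢ vertex r g (next i)
      vertices-≢ r g i p = vertex-loopless r g i (cong proj₁ p)

      translate : Fin n → ℤ → PartialGraph V
      translate r g = cycleGraph (vertex r g) (vertices-≢ r g)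

      𝒟 : Pred (PartialGraph V) 0ℓ
      𝒟 B = ∃₂ λ r g → B ≈ translate r g

      translate-cong : ∀ {r r′ g g′} → r ≡ r′ → g ≡ g′ [mod v ] → translate r g ≈ translate r′ g′
      translate-cong {r} {r′} {g} {g′} refl p = cycleGraph-cong {w = vertex r g} {vertex r g′} (vertices-≢ r g) (vertices-≢ r g′)
        λ i → point-cong (+-≡mod (≡mod-refl {x = c r i}) p)

      vertex-injective : ∀ r g → Injective _≡_ _≡_ (vertex r g)
      vertex-injective r g {i} {j} p = vertices-distinct r (congruent (difference (point-injective p) ∣-via eq (c r i) (c r j) g))
        where eq : ∀ a b g → a + g - (b + g) ≡ a - b
              eq = solve-∀

      -- Uniqueness in the partition. The edge has equal steps in both translates, or opposite ones
      -- if the directions differ. Opposite steps never occur, and equal steps sit at the same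
      -- position of the same base cycle, so the amounts of translation agree.
      common-edge : ∀ {u w r g r′ g′} → PartialGraph.Adj (translate r g) u w → PartialGraph.Adj (translate r′ g′) u w →
        (r ≡ r′) × (g ≡ g′ [mod v ])
      common-edge {u} {w} {r} {g} {r′} {g′} (i , e) (i′ , e′) = [ same , opposite ]′ (point-sameEdge (sameEdge-meet e e′))
        where
        same : c r i + g ≡ c r′ i′ + g′ [mod v ] × c r (next i) + g ≡ c r′ (next i′) + g′ [mod v ] →
              (r ≡ r′) × (g ≡ g′ [mod v ])
        same (p , p′) = aligned (step-injective {r} {i} {r′} {i′}
          (≡mod-differences {_} {c r i} {c r′ i′} {c r (next i)} {c r′ (next i′)} {g} {g′} p p′)) p
          where
          aligned : ∀ {r′ i′} → (r , i) ≡ (r′ , i′) → c r i + g ≡ c r′ i′ + g′ [mod v ] →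
              (r ≡ r′) × (g ≡ g′ [mod v ])
          aligned refl p = refl , +-cancelˡ-≡mod (c r i) p
        opposite : c r i + g ≡ c r′ (next i′) + g′ [mod v ] × c r (next i) + g ≡ c r′ i′ + g′ [mod v ] →
              (r ≡ r′) × (g ≡ g′ [mod v ])
        opposite (p , p′) = ⊥-elim (step≢-step {r} {i} {r′} {i′} (≡mod-neg-difference {_} {step (c r) i} {c r′ i′} {c r′ (next i′)}
          (≡mod-differences {_} {c r i} {c r′ (next i′)} {c r (next i)} {c r′ i′} {g} {g′} p p′)))

      edge-through : ∀ {u w} → ¬ + q ∣ index w - index u → ∃₂ λ r g → PartialGraph.Adj (translate r g) u w
      edge-through {u} {w} q∤δ = build (covers (index w - index u) q∤δ)
        where
        eq₁ : ∀ c x → c + (x - c) ≡ x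
        eq₁ = solve-∀
        eq₂ : ∀ c c′ x → c′ + (x - c) ≡ x + (c′ - c)
        eq₂ = solve-∀
        eq₃ : ∀ x y → x + (y - x) ≡ y
        eq₃ = solve-∀
        eq₄ : ∀ x y → y + - (y - x) ≡ x
        eq₄ = solve-∀
        eq₅ : ∀ d → - - d ≡ d
        eq₅ = solve-∀
        start : ∀ x r i → point (c r i + (index x - c r i)) ≡ x
        start x r i = trans (cong point (eq₁ (c r i) (index x))) (point-index x)
        finish : ∀ x y r i → index x + step (c r) i ≡ index y [mod v ] → point (c r (next i) + (index x - c r i)) ≡ y
        finish x y r i p = trans (point-cong (≡mod-trans (≡mod-reflexive (eq₂ (c r i) (c r (next i)) (index x))) p)) (point-index y)
        build : (∃ λ r → Hits (c r) (index w - index u)) → ∃₂ λ r g → PartialGraph.Adj (translate r g) u w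
        -- The translation carries the tail of the step to `u` if the step runs from `u` to `w`, and
        -- to `w` if the sign is reversed.
        build (r , i , inj₁ p) = r , index u - c r i , i , inj₁ (sym (start u r i) , sym (finish u w r i
          (≡mod-trans (+-≡mod (≡mod-refl {x = index u}) (≡mod-sym p)) (≡mod-reflexive (eq₃ (index u) (index w))))))
        build (r , i , inj₂ p) = r , index w - c r i , i , inj₂ (sym (finish w u r i
          (≡mod-trans (+-≡mod (≡mod-refl {x = index w}) (≡mod-sym (≡mod-trans (-‿≡mod p) (≡mod-reflexive (eq₅ (step (c r) i))))))
            (≡mod-reflexive (eq₄ (index u) (index w))))) , sym (start w r i))

      decomposition : IsCycleDecomposition k K[ q × k ] 𝒟
      decomposition = record
        { respects  = λ {B} {B′} B≈B′ (r , g , B≈) → r , g , ≈-trans B′ B (translate r g) (≈-sym B B′ B≈B′) B≈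
        ; subgraph  = λ (r , g , B≈) {u} {w} e → subgraph′ (Equivalence.to (proj₂ B≈ u w) e)
        ; cycle     = λ (r , g , B≈) → 3≤k , vertex r g , vertex-injective r g , B≈
        ; partition = λ {u} {w} u≁w →
            let q∤δ q∣δ = u≁w (sym (trans (sym (residue-index w)) (trans (residue-cong q (congruent q∣δ)) (residue-index u))))
                r , g , e = edge-through {u} {w} q∤δ
            in translate r g , ((r , g , ≈-refl (translate r g)) , e) , λ {B} ((r′ , g′ , B≈) , e′) →
              let r≡r′ , g≡g′ = common-edge {u} {w} {r} {g} {r′} {g′} e (Equivalence.to (proj₂ B≈ u w) e′)
              in ≈-trans (translate r g) (translate r′ g′) B (translate-cong r≡r′ g≡g′) (≈-sym B (translate r′ g′) B≈)
        }
        where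
        subgraph′ : ∀ {r g u w} → PartialGraph.Adj (translate r g) u w → proj₁ u ≢ proj₁ w
        subgraph′ {r} {g} (i , inj₁ (refl , refl)) = vertex-loopless r g i
        subgraph′ {r} {g} (i , inj₂ (refl , refl)) = vertex-loopless r g i ∘ sym
        residue-index : ∀ u → residue q (index u) ≡ proj₁ u
        residue-index u = toℕ-≡mod⇒≡ (≡mod-trans (≡mod-sym (residue-≡mod q (index u))) (index-≡modq u))

      image-translate : ∀ {h z} → ShiftsBy h z → ∀ {B r g} → B ≈ translate r g → image h B ≈ translate r (g + z)
      image-translate {h} {z} h-shifts {B} {r} {g} (vs , es) = ≈-trans (image h B) (image h (translate r g)) (translate r (g + z))
        (vs ∘ Inverse.from h , λ u w → es (Inverse.from h u) (Inverse.from h w))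
        ( (λ u → mk⇔ (λ (i , p) → i , to-vertex i p) (λ (i , p) → i , from-vertex i p))
        , (λ u w → mk⇔ (λ (i , e) → i , to-edge i e) (λ (i , e) → i , from-edge i e)))
        where
        moved : ∀ i → Inverse.to h (vertex r g i) ≡ vertex r (g + z) i
        moved i = trans (h-shifts (c r i + g)) (cong point (ℤ.+-assoc (c r i) g z))
        to-vertex : ∀ {u} i → vertex r g i ≡ Inverse.from h u → vertex r (g + z) i ≡ u
        to-vertex i p = trans (sym (moved i)) (Inverse.inverseˡ h p)
        from-vertex : ∀ {u} i → vertex r (g + z) i ≡ u → vertex r g i ≡ Inverse.from h u
        from-vertex i p = sym (Inverse.inverseʳ h (trans (sym p) (sym (moved i))))
        to-edge : ∀ {u w} i → SameEdge (Inverse.from h u) (Inverse.from h w) (vertex r g i) (vertex r g (next i)) →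
          SameEdge u w (vertex r (g + z) i) (vertex r (g + z) (next i))
        to-edge i (inj₁ (p , p′)) = inj₁ (sym (to-vertex i (sym p)) , sym (to-vertex (next i) (sym p′)))
        to-edge i (inj₂ (p , p′)) = inj₂ (sym (to-vertex (next i) (sym p)) , sym (to-vertex i (sym p′)))
        from-edge : ∀ {u w} i → SameEdge u w (vertex r (g + z) i) (vertex r (g + z) (next i)) →
          SameEdge (Inverse.from h u) (Inverse.from h w) (vertex r g i) (vertex r g (next i))
        from-edge i (inj₁ (p , p′)) = inj₁ (sym (from-vertex i (sym p)) , sym (from-vertex (next i) (sym p′)))
        from-edge i (inj₂ (p , p′)) = inj₂ (sym (from-vertex (next i) (sym p)) , sym (from-vertex i (sym p′)))

      image-image : ∀ h (B : PartialGraph V) → B ≈ image (↔-sym h) (image h B)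
      image-image h B = (λ u → subst (λ u′ → Vertex u ⇔ Vertex u′) (back u) ⇔.refl) ,
                        (λ u w → subst₂ (λ u′ w′ → Adj u w ⇔ Adj u′ w′) (back u) (back w) ⇔.refl)
        where
        open PartialGraph B
        module ⇔ = IsEquivalence ⇔-isEquivalence
        back : ∀ u → u ≡ Inverse.from h (Inverse.to h u)
        back u = sym (Inverse.strictlyInverseʳ h u)

      -- The inverse of a translation is a translation, so the converse is the forward direction
      -- applied to `image h B`.
      automorphism : ∀ {h z} → ShiftsBy h z → IsAutomorphism 𝒟 h
      automorphism {h} {z} h-shifts B = mk⇔
        (λ (r , g , B≈) → r , g + z , image-translate {h} {z} h-shifts {B} {r} {g} B≈)
        (λ (r , g , hB≈) → r , g + - z , ≈-trans B (image (↔-sym h) (image h B)) (translate r (g + - z)) (image-image h B)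
          (image-translate {↔-sym h} { - z} (↔-sym-shifts {h} {z} h-shifts) {image h B} {r} {g} hB≈))

      ⟨σ⟩-automorphism : ∀ {h} → h ∈ ⟨ σ ⟩ → IsAutomorphism 𝒟 h
      ⟨σ⟩-automorphism {h} h∈⟨σ⟩ = let z , h-shifts = ⟨σ⟩-shifts {h} h∈⟨σ⟩ in automorphism {h} {z} h-shifts

      cyclic : IsCyclic 𝒟
      cyclic = σ , (λ {h} → ⟨σ⟩-automorphism {h}) , ⟨σ⟩-sharplyTransitive

    -- Reflection and orthogonality.

    reflect : (Fin n → Fin k → ℤ) → Fin n → Fin k → ℤ
    reflect c r i = - c r i

    -‿injective-≡mod : ∀ {x y} → - x ≡ - y [mod v ] → x ≡ y [mod v ]
    -‿injective-≡mod {x} {y} (congruent p) = congruent (∣m⇒∣-m p ∣-via eq x y)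
      where eq : ∀ x y → - (- x - - y) ≡ x - y
            eq = solve-∀

    reflect-base : ∀ {c} → BaseCycles c → BaseCycles (reflect c)
    reflect-base {c} base = record
      { vertices-distinct  = λ r p → vertices-distinct r (-‿injective-≡mod p)
      ; midpoints-distinct = λ r {i} {j} p → midpoints-distinct r (-‿injective-≡mod
          (≡mod-trans (≡mod-reflexive (eq₁ (c r i) (c r (next i)))) (≡mod-trans p (≡mod-reflexive (sym (eq₁ (c r j) (c r (next j))))))))
      ; covers = λ δ q∤δ → let r , i , p = covers δ q∤δ in r , i ,
          [ (λ p → inj₂ (≡mod-trans p (≡mod-reflexive (eq₂ (c r i) (c r (next i)))))) ,
            (λ p → inj₁ (≡mod-trans p (≡mod-reflexive (eq₃ (c r i) (c r (next i)))))) ]′ p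
      }
      where
      open BaseCycles base
      eq₁ : ∀ a b → - (a + b) ≡ - a + - b
      eq₁ = solve-∀
      eq₂ : ∀ a b → b - a ≡ - (- b - - a)
      eq₂ = solve-∀
      eq₃ : ∀ a b → - (b - a) ≡ - b - - a
      eq₃ = solve-∀

    module _ {c : Fin n → Fin k → ℤ} (base : BaseCycles c) where

      open BaseCycles base
      open Counting {c} covers
      private
        module T = Translates base
        module T′ = Translates (reflect-base base)

      -- Reflection reverses steps, so the shared edge must be traversed in opposite directions. Its
      -- two steps then agree, hence belong to the same position of the same base cycle, and
      -- equating endpoints gives the sum. The right-hand side depends on the two cycles only and
      -- not on the edge.
      reflected-common-edge : ∀ {u w r g r′ g′} → (e : PartialGraph.Adj (T.translate r g) u w) →
        PartialGraph.Adj (T′.translate r′ g′) u w →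
        midpoint (c r) (proj₁ e) ≡ g′ - g [mod v ]
      reflected-common-edge {u} {w} {r} {g} {r′} {g′} (i , e) (i′ , e′) = [ same , opposite ]′ (point-sameEdge (sameEdge-meet e e′))
        where
        eq₁ : ∀ x y → - y - - x ≡ - (y - x)
        eq₁ = solve-∀
        eq₂ : ∀ x y → - x - - y ≡ y - x
        eq₂ = solve-∀
        same : c r i + g ≡ - c r′ i′ + g′ [mod v ] × c r (next i) + g ≡ - c r′ (next i′) + g′ [mod v ] →
              midpoint (c r) i ≡ g′ - g [mod v ]
        same (p , p′) = ⊥-elim (step≢-step {r} {i} {r′} {i′} (≡mod-trans
          (≡mod-differences {_} {c r i} { - c r′ i′} {c r (next i)} { - c r′ (next i′)} {g} {g′} p p′)
          (≡mod-reflexive (eq₁ (c r′ i′) (c r′ (next i′))))))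
        opposite : c r i + g ≡ - c r′ (next i′) + g′ [mod v ] × c r (next i) + g ≡ - c r′ i′ + g′ [mod v ] →
              midpoint (c r) i ≡ g′ - g [mod v ]
        opposite (p , p′) = aligned (step-injective {r} {i} {r′} {i′} (≡mod-trans
          (≡mod-differences {_} {c r i} { - c r′ (next i′)} {c r (next i)} { - c r′ i′} {g} {g′} p p′)
          (≡mod-reflexive (eq₂ (c r′ i′) (c r′ (next i′)))))) p
          where
          aligned : ∀ {r′ i′} → (r , i) ≡ (r′ , i′) → c r i + g ≡ - c r′ (next i′) + g′ [mod v ] →
              midpoint (c r) i ≡ g′ - g [mod v ]
          aligned refl p = +-swap-≡mod {c r i} {c r (next i)} {g} {g′} p

      orthogonal : Orthogonal T.𝒟 T′.𝒟
      orthogonal (r , g , B≈) (r′ , g′ , B′≈) {u} {w} {u′} {w′} e₁ e₁′ e₂ e₂′ =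
        let i , f = Equivalence.to (proj₂ B≈ u w) e₁
            j , f′ = Equivalence.to (proj₂ B≈ u′ w′) e₂
            m = reflected-common-edge {u} {w} {r} {g} {r′} {g′} (i , f) (Equivalence.to (proj₂ B′≈ u w) e₁′)
            m′ = reflected-common-edge {u′} {w′} {r} {g} {r′} {g′} (j , f′) (Equivalence.to (proj₂ B′≈ u′ w′) e₂′)
            -- Both shared edges have the midpoint `g′ - g`, so they occupy the same position of the
            -- base cycle.
            i≡j = midpoints-distinct r (≡mod-trans m (≡mod-sym m′))
        in sameEdge-join f (subst (λ j → SameEdge u′ w′ (T.vertex r g j) (T.vertex r g (next j))) (sym i≡j) f′)

      orthogonal-decompositions : ∃₂ λ 𝒟 𝒟′ →
        IsCycleDecomposition k K[ q × k ] 𝒟 × IsCyclic 𝒟 ×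
        IsCycleDecomposition k K[ q × k ] 𝒟′ × IsCyclic 𝒟′ ×
        Orthogonal 𝒟 𝒟′
      orthogonal-decompositions = T.𝒟 , T′.𝒟 , T.decomposition , T.cyclic , T′.decomposition , T′.cyclic ,
        λ {B} {B′} → orthogonal {B} {B′}

  -- Base cycles with symbolic classes.

  -- A vertex x r + y s + b q with symbolic r and s is written ((x , y) , b).
  Form Symbol : Set
  Form = ℤ × ℤ
  Symbol = Form × ℤ

  _⊕_ _⊝_ : Symbol → Symbol → Symbol
  ((x , y) , b) ⊕ ((x′ , y′) , b′) = (x + x′ , y + y′) , b + b′
  ((x , y) , b) ⊝ ((x′ , y′) , b′) = (x - x′ , y - y′) , b - b′

  negate : Form → Form
  negate (x , y) = - x , - y

  _≟ᶠᵒʳᵐ_ : DecidableEquality Form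
  _≟ᶠᵒʳᵐ_ = ×.≡-dec ℤ._≟_ ℤ._≟_

  open import Data.List.Membership.DecPropositional _≟ᶠᵒʳᵐ_ using (_∈?_) renaming (_∈_ to _∈ˡ_)

  module _ {k : ℕ} where

    symbolicStep symbolicMidpoint : (Fin k → Symbol) → Fin k → Symbol
    symbolicStep p i = p (next i) ⊝ p i
    symbolicMidpoint p i = p i ⊕ p (next i)

    -- Equal forms leave a multiple of q, which vanishes modulo kq only if k divides its
    -- coefficient. Different forms are told apart already modulo q, provided that their difference
    -- is known not to be a multiple of q; `nonzero` lists the differences for which this is
    -- granted.
    Separated : List Form → (Fin k → Symbol) → Set
    Separated nonzero p = ∀ i j → i ≡ j
      ⊎ (proj₁ (p i) ≡ proj₁ (p j) × ¬ + k ∣ proj₂ (p i) - proj₂ (p j))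
      ⊎ proj₁ (p i ⊝ p j) ∈ˡ nonzero

    separated? : ∀ nonzero p → Dec (Separated nonzero p)
    separated? nonzero p = all? λ i → all? λ j → (i ≟ᶠ j)
      ⊎-dec ((proj₁ (p i) ≟ᶠᵒʳᵐ proj₁ (p j) ×-dec ¬? (+ k ∣? (proj₂ (p i) - proj₂ (p j))))
      ⊎-dec (proj₁ (p i ⊝ p j) ∈? nonzero))

    Attains : (Fin k → Symbol) → Form → ℤ → Set
    Attains p f j = ∃ λ i →
      (proj₁ (symbolicStep p i) ≡ f × + k ∣ proj₂ (symbolicStep p i) - j)
      ⊎ (proj₁ (symbolicStep p i) ≡ negate f × + k ∣ proj₂ (symbolicStep p i) + j)

    attains? : ∀ p f j → Dec (Attains p f j)
    attains? p f j = any? λ i →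
      ((proj₁ (symbolicStep p i) ≟ᶠᵒʳᵐ f) ×-dec (+ k ∣? (proj₂ (symbolicStep p i) - j)))
      ⊎-dec ((proj₁ (symbolicStep p i) ≟ᶠᵒʳᵐ negate f) ×-dec (+ k ∣? (proj₂ (symbolicStep p i) + j)))

  module Templates (n k : ℕ) .{{_ : NonZero (2 ℕ.* n ℕ.+ 1)}} .{{_ : NonZero k}} where

    open CyclicSystem n k

    module _ (r s : ℤ) where

      evalForm : Form → ℤ
      evalForm (x , y) = x * r + y * s

      eval : Symbol → ℤ
      eval (f , b) = evalForm f + b * + q

      private
        eval-⊕ : ∀ p p′ → eval p + eval p′ ≡ eval (p ⊕ p′)
        eval-⊕ ((x , y) , b) ((x′ , y′) , b′) = eq r s (+ q) x y b x′ y′ b′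
          where eq : ∀ r s q x y b x′ y′ b′ → x * r + y * s + b * q + (x′ * r + y′ * s + b′ * q)
                  ≡ (x + x′) * r + (y + y′) * s + (b + b′) * q
                eq = solve-∀

        eval-⊝ : ∀ p p′ → eval p - eval p′ ≡ eval (p ⊝ p′)
        eval-⊝ ((x , y) , b) ((x′ , y′) , b′) = eq r s (+ q) x y b x′ y′ b′
          where eq : ∀ r s q x y b x′ y′ b′ → x * r + y * s + b * q - (x′ * r + y′ * s + b′ * q)
                  ≡ (x - x′) * r + (y - y′) * s + (b - b′) * q
                eq = solve-∀

        evalForm-negate : ∀ f b → evalForm (negate f) + - b * + q ≡ - (evalForm f + b * + q)
        evalForm-negate (x , y) b = eq r s (+ q) x y b
          where eq : ∀ r s q x y b → - x * r + - y * s + - b * q ≡ - (x * r + y * s + b * q)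
                eq = solve-∀

        q∣evalForm : ∀ p → + q ∣ eval p → + q ∣ evalForm (proj₁ p)
        q∣evalForm (f , b) = λ d → ∣m+n∣n⇒∣m {m = evalForm f} {b * + q} d (∣n⇒∣m*n b ∣-refl)

      module _ {nonzero : List Form} (q∤nonzero : All (λ f → ¬ + q ∣ evalForm f) nonzero) where

        separated⇒distinct : ∀ {p : Fin k → Symbol} → Separated nonzero p → ∀ {i j} → eval (p i) ≡ eval (p j) [mod v ] → i ≡ j
        separated⇒distinct {p} sep {i} {j} e = go (sep i j)
          where
          clash : ∀ {f b f′ b′} → f ≡ f′ → evalForm f + b * + q ≡ evalForm f′ + b′ * + q [mod v ] → + k ∣ b - b′
          clash {f} {b} {_} {b′} refl (congruent d) = ∣-cancel (evalForm f) b b′ d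
          go : _ → i ≡ j
          go (inj₁ i≡j) = i≡j
          go (inj₂ (inj₁ (f≡f′ , k∤))) = contradiction (clash {b = proj₂ (p i)} {b′ = proj₂ (p j)} f≡f′ e) k∤
          go (inj₂ (inj₂ f∈)) = contradiction
            (q∣evalForm (p i ⊝ p j) (∣-trans q∣v (difference e) ∣-via eval-⊝ (p i) (p j)))
            (All.lookup q∤nonzero f∈)

        midpoints-separated⇒distinct : ∀ {p : Fin k → Symbol} → Separated nonzero (symbolicMidpoint p) → ∀ {i j} →
          midpoint (eval ∘ p) i ≡ midpoint (eval ∘ p) j [mod v ] → i ≡ j
        midpoints-separated⇒distinct {p} sep {i} {j} e = separated⇒distinct {symbolicMidpoint p} sep
          (≡mod-trans (≡mod-reflexive (sym (eval-⊕ (p i) (p (next i)))))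
          (≡mod-trans e (≡mod-reflexive (eval-⊕ (p j) (p (next j))))))

      attains⇒hits : ∀ {p f j δ} → Attains p f j → δ ≡ eval (f , j) [mod v ] → Hits (eval ∘ p) δ
      attains⇒hits {p} {f} {j} {δ} (i , a) δ≡ = i , go a
        where
        go : _ → δ ≡ step (eval ∘ p) i [mod v ] ⊎ δ ≡ - step (eval ∘ p) i [mod v ]
        go (inj₁ (f≡ , k∣)) = inj₁ (≡mod-trans δ≡ (≡mod-sym (≡mod-trans (≡mod-reflexive
          (trans (eval-⊝ (p (next i)) (p i)) (cong (λ f → eval (f , proj₂ (symbolicStep p i))) f≡)))
          (*q-≡mod (evalForm f) {proj₂ (symbolicStep p i)} {j} (congruent k∣)))))
        go (inj₂ (f≡ , k∣)) = inj₂ (≡mod-trans δ≡ (≡mod-sym (≡mod-trans (-‿≡mod (≡mod-trans (≡mod-reflexive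
          (trans (eval-⊝ (p (next i)) (p i)) (cong (λ f → eval (f , proj₂ (symbolicStep p i))) f≡)))
          (*q-≡mod (evalForm (negate f)) {proj₂ (symbolicStep p i)} { - j}
            (congruent (k∣ ∣-via cong (λ j → proj₂ (symbolicStep p i) + j) (sym (ℤ.neg-involutive j)))))))
          (≡mod-reflexive (trans (cong -_ (evalForm-negate f j)) (ℤ.neg-involutive (eval (f , j))))))))

    hits-neg : ∀ {c δ} → Hits c (- δ) → Hits c δ
    hits-neg {c} {δ} (i , inj₁ p) = i , inj₂ (≡mod-trans (≡mod-reflexive (sym (ℤ.neg-involutive δ))) (-‿≡mod p))
    hits-neg {c} {δ} (i , inj₂ p) = i , inj₁ (≡mod-trans (≡mod-reflexive (sym (ℤ.neg-involutive δ)))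
      (≡mod-trans (-‿≡mod p) (≡mod-reflexive (ℤ.neg-involutive (step c i)))))

    ≡modq⇒coset : ∀ {δ d} → δ ≡ d [mod + q ] → ∃ λ (j : Fin k) → δ ≡ d + + toℕ j * + q [mod v ]
    ≡modq⇒coset {δ} {d} (congruent (divides t e)) = residue k t ,
      ≡mod-trans (≡mod-reflexive (trans (eq δ d) (cong (λ z → d + z) e))) (*q-≡mod d (residue-≡mod k t))
      where eq : ∀ δ d → δ ≡ d + (δ - d)
            eq = solve-∀

    -- Up to sign every difference is d + jq with 1 ≤ d ≤ n.
    covers-by-cosets : ∀ {c : Fin n → Fin k → ℤ} →
      (∀ (d : Fin n) (j : Fin k) {δ} → δ ≡ + ℕ.suc (toℕ d) + + toℕ j * + q [mod v ] → ∃ λ r → Hits (c r) δ) →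
      Covers c
    covers-by-cosets {c} hit δ q∤δ = go (±residue n δ q∤δ)
      where
      go : (∃ λ (d : Fin n) → δ ≡ + ℕ.suc (toℕ d) [mod + q ] ⊎ δ ≡ - + ℕ.suc (toℕ d) [mod + q ]) → ∃ λ r → Hits (c r) δ
      go (d , inj₁ p) = let j , p′ = ≡modq⇒coset p in hit d j p′
      go (d , inj₂ p) =
        let j , p′ = ≡modq⇒coset (≡mod-trans (-‿≡mod p) (≡mod-reflexive (ℤ.neg-involutive (+ ℕ.suc (toℕ d)))))
            r , h = hit d j p′
        in r , hits-neg {c r} h

  -- Cycles within one class: k = 4, 5, 7, 8, 9.

  bounded∤ : ∀ {m} z → 0 ℕ.< ∣ z ∣ → ∣ z ∣ ℕ.< m → ¬ + m ∣ z
  bounded∤ z 0<∣z∣ ∣z∣<m m∣z = ℕ.>⇒∤ {{ℕ.>-nonZero 0<∣z∣}} ∣z∣<m (∣⇒∣ᵤ m∣z)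

  parity : ∀ t → ∃ λ a → t ≡ a ℕ.+ a ⊎ t ≡ ℕ.suc (a ℕ.+ a)
  parity ℕ.zero = 0 , inj₁ refl
  parity (ℕ.suc t) = go (parity t)
    where
    go : _ → ∃ λ a → ℕ.suc t ≡ a ℕ.+ a ⊎ ℕ.suc t ≡ ℕ.suc (a ℕ.+ a)
    go (a , inj₁ p) = a , inj₂ (cong ℕ.suc p)
    go (a , inj₂ p) = ℕ.suc a , inj₁ (trans (cong ℕ.suc p) (cong ℕ.suc (sym (ℕ.+-suc a a))))

  -- Halving up to sign modulo the odd number q = 2n + 1: one of d + 1 and q - (d + 1) is even, and
  -- half of it lies between 1 and n.
  signedHalf : ∀ {n} (d : Fin n) →
    (∃ λ (e : Fin n) → ℕ.suc (toℕ e) ℕ.+ ℕ.suc (toℕ e) ≡ ℕ.suc (toℕ d))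
    ⊎ (∃ λ (e : Fin n) → ℕ.suc (toℕ e) ℕ.+ ℕ.suc (toℕ e) ℕ.+ ℕ.suc (toℕ d) ≡ 2 ℕ.* n ℕ.+ 1)
  signedHalf {n} d = go (parity (toℕ d))
    where
    eq : ∀ a e → ℕ.suc e ℕ.+ ℕ.suc e ℕ.+ ℕ.suc (a ℕ.+ a) ≡ 2 ℕ.* (ℕ.suc a ℕ.+ e) ℕ.+ 1
    eq = ℕ-Solver.solve-∀
    go : _ → _
    go (a , inj₁ p) = inj₂ (fromℕ< {e} e<n , (begin
      ℕ.suc (toℕ (fromℕ< e<n)) ℕ.+ ℕ.suc (toℕ (fromℕ< e<n)) ℕ.+ ℕ.suc (toℕ d)
        ≡⟨ cong₂ (λ e t → ℕ.suc e ℕ.+ ℕ.suc e ℕ.+ ℕ.suc t) (toℕ-fromℕ< e<n) p ⟩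
      ℕ.suc e ℕ.+ ℕ.suc e ℕ.+ ℕ.suc (a ℕ.+ a)   ≡⟨ eq a e ⟩
      2 ℕ.* (ℕ.suc a ℕ.+ e) ℕ.+ 1               ≡⟨ cong (λ n → 2 ℕ.* n ℕ.+ 1) a+e≡n ⟩
      2 ℕ.* n ℕ.+ 1                             ∎))
      where
      open ≡-Reasoning
      -- Here d + 1 = 2a + 1, so half of q - (d + 1) is n - a, the value that the index n - a - 1
      -- stands for.
      e = n ℕ.∸ ℕ.suc a
      a+e≡n : ℕ.suc a ℕ.+ e ≡ n
      a+e≡n = ℕ.m+[n∸m]≡n (ℕ.≤-<-trans (subst (a ℕ.≤_) (sym p) (ℕ.m≤m+n a a)) (toℕ<n d))
      e<n : e ℕ.< n
      e<n = subst (e ℕ.<_) a+e≡n (ℕ.s≤s (ℕ.m≤n+m e a))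
    go (a , inj₂ p) = inj₁ (fromℕ< {a} a<n , trans (cong (λ e → ℕ.suc e ℕ.+ ℕ.suc e) (toℕ-fromℕ< a<n))
      (trans (cong ℕ.suc (ℕ.+-suc a a)) (cong ℕ.suc (sym p))))
      where
      a<n : a ℕ.< n
      a<n = ℕ.<-trans (subst (a ℕ.<_) (sym p) (ℕ.s≤s (ℕ.m≤m+n a a))) (toℕ<n d)

  -- For 1 ≤ r ≤ n both r and 2r lie strictly between 0 and q. The multiple 3r has to stay out,
  -- because it equals q for r = q/3 when 3 divides q.
  x-axis : List Form
  x-axis = (1ℤ , 0ℤ) ∷ (-1ℤ , 0ℤ) ∷ (+ 2 , 0ℤ) ∷ (- + 2 , 0ℤ) ∷ []

  module OneClass (n k : ℕ) .{{_ : NonZero (2 ℕ.* n ℕ.+ 1)}} .{{_ : NonZero k}} (p : Fin k → Symbol)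
    (vertices : Separated x-axis p) (midpoints : Separated x-axis (symbolicMidpoint p)) where

    open CyclicSystem n k
    open Templates n k

    base : Fin n → Fin k → ℤ
    base d = eval (+ ℕ.suc (toℕ d)) 0ℤ ∘ p

    private
      double<q : (d : Fin n) → ℕ.suc (toℕ d) ℕ.+ ℕ.suc (toℕ d) ℕ.< q
      double<q d = subst (ℕ.suc (toℕ d) ℕ.+ ℕ.suc (toℕ d) ℕ.<_) (eq n) (ℕ.s≤s (ℕ.+-mono-≤ (toℕ<n d) (toℕ<n d)))
        where eq : ∀ n → ℕ.suc (n ℕ.+ n) ≡ 2 ℕ.* n ℕ.+ 1
              eq = ℕ-Solver.solve-∀

      single<q : (d : Fin n) → ℕ.suc (toℕ d) ℕ.< q
      single<q d = ℕ.≤-<-trans (ℕ.m≤m+n (ℕ.suc (toℕ d)) (ℕ.suc (toℕ d))) (double<q d)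

      q∤x-axis : ∀ d → All (λ f → ¬ + q ∣ evalForm (+ ℕ.suc (toℕ d)) 0ℤ f) x-axis
      q∤x-axis d =
        (λ h → bounded∤ r ℕ.z<s (single<q d) (h ∣-via eq₁ r)) ∷
        (λ h → bounded∤ r ℕ.z<s (single<q d) (∣m⇒∣-m h ∣-via eq₂ r)) ∷
        (λ h → bounded∤ (r + r) ℕ.z<s (double<q d) (h ∣-via eq₃ r)) ∷
        (λ h → bounded∤ (r + r) ℕ.z<s (double<q d) (∣m⇒∣-m h ∣-via eq₄ r)) ∷ []
        where
        r = + ℕ.suc (toℕ d)
        eq₁ : ∀ r → 1ℤ * r + 0ℤ * 0ℤ ≡ r
        eq₁ = solve-∀
        eq₂ : ∀ r → - (-1ℤ * r + 0ℤ * 0ℤ) ≡ r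
        eq₂ = solve-∀
        eq₃ : ∀ r → + 2 * r + 0ℤ * 0ℤ ≡ r + r
        eq₃ = solve-∀
        eq₄ : ∀ r → - (- + 2 * r + 0ℤ * 0ℤ) ≡ r + r
        eq₄ = solve-∀

      baseCycles : Covers base → BaseCycles base
      baseCycles covers = record
        { vertices-distinct  = λ d → separated⇒distinct _ _ (q∤x-axis d) {p} vertices
        ; midpoints-distinct = λ d → midpoints-separated⇒distinct _ _ (q∤x-axis d) {p} midpoints
        ; covers             = covers
        }

      hits-single : ∀ (d : Fin n) j {δ} → Attains p (1ℤ , 0ℤ) j → δ ≡ + ℕ.suc (toℕ d) + j * + q [mod v ] → Hits (base d) δ
      hits-single d j attains δ≡ = attains⇒hits _ _ {p} attains (≡mod-trans δ≡ (≡mod-reflexive (eq (+ ℕ.suc (toℕ d)) (j * + q))))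
        where eq : ∀ r jq → r + jq ≡ 1ℤ * r + 0ℤ * 0ℤ + jq
              eq = solve-∀

      hits-double : ∀ (e : Fin n) j {δ} → Attains p (+ 2 , 0ℤ) j →
        δ ≡ + (ℕ.suc (toℕ e) ℕ.+ ℕ.suc (toℕ e)) + j * + q [mod v ] → Hits (base e) δ
      hits-double e j attains δ≡ = attains⇒hits _ _ {p} attains (≡mod-trans δ≡ (≡mod-reflexive (eq (+ ℕ.suc (toℕ e)) (j * + q))))
        where eq : ∀ r jq → r + r + jq ≡ + 2 * r + 0ℤ * 0ℤ + jq
              eq = solve-∀

    even-baseCycles : (∀ (j : Fin k) → Attains p (1ℤ , 0ℤ) (+ toℕ j)) → BaseCycles base
    even-baseCycles attains = baseCycles (covers-by-cosets {base} λ d j δ≡ → d , hits-single d (+ toℕ j) (attains j) δ≡)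

    -- The steps 2r + hq stand in for the missing steps r + hq: modulo kq, the
    -- negative of d + hq is (q - d) + hq, and one of d and q - d is even.
    odd-baseCycles : ∀ h → k ≡ 2 ℕ.* h ℕ.+ 1 →
      (∀ (j : Fin k) → toℕ j ≡ h ⊎ Attains p (1ℤ , 0ℤ) (+ toℕ j)) → Attains p (+ 2 , 0ℤ) (+ h) → BaseCycles base
    odd-baseCycles h k≡2h+1 attains attains-2 = baseCycles (covers-by-cosets {base} λ d j → cover d j (attains j))
      where
      cover : ∀ (d : Fin n) (j : Fin k) → toℕ j ≡ h ⊎ Attains p (1ℤ , 0ℤ) (+ toℕ j) →
        ∀ {δ} → δ ≡ + ℕ.suc (toℕ d) + + toℕ j * + q [mod v ] → ∃ λ r → Hits (base r) δ
      cover d j (inj₂ a) δ≡ = d , hits-single d (+ toℕ j) a δ≡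
      cover d j (inj₁ j≡h) {δ} δ≡ = halve (signedHalf d)
        where
        δ≡′ : δ ≡ + ℕ.suc (toℕ d) + + h * + q [mod v ]
        δ≡′ = subst (λ j → δ ≡ + ℕ.suc (toℕ d) + + j * + q [mod v ]) j≡h δ≡
        complement : ∀ {e} → e ℕ.+ ℕ.suc (toℕ d) ≡ q → - δ ≡ + e + + h * + q [mod v ]
        complement {e} e+d≡q = ≡mod-trans (-‿≡mod δ≡′) (congruent (divides -1ℤ (begin
          - (+ ℕ.suc (toℕ d) + + h * + q) - (+ e + + h * + q)
            ≡⟨ eq (+ ℕ.suc (toℕ d)) (+ e) (+ h) (+ q) ⟩
          - (+ e + + ℕ.suc (toℕ d)) - + 2 * + h * + q
            ≡⟨ cong (λ z → - + z - + 2 * + h * + q) e+d≡q ⟩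
          - + q - + 2 * + h * + q
            ≡⟨ eq′ (+ h) (+ q) ⟩
          -1ℤ * (+ q * (+ 2 * + h + 1ℤ))
            ≡⟨ cong (λ z → -1ℤ * (+ q * (z + 1ℤ))) (ℤ.pos-* 2 h) ⟨
          -1ℤ * (+ q * + (2 ℕ.* h ℕ.+ 1))
            ≡⟨ cong (λ k → -1ℤ * (+ q * + k)) k≡2h+1 ⟨
          -1ℤ * v ∎)))
          where
          open ≡-Reasoning
          eq : ∀ d e h q → - (d + h * q) - (e + h * q) ≡ - (e + d) - + 2 * h * q
          eq = solve-∀
          eq′ : ∀ h q → - q - + 2 * h * q ≡ -1ℤ * (q * (+ 2 * h + 1ℤ))
          eq′ = solve-∀
        halve : _ → ∃ λ r → Hits (base r) δ
        halve (inj₁ (e , p)) = e , hits-double e (+ h) attains-2 (subst (λ z → δ ≡ + z + + h * + q [mod v ]) (sym p) δ≡′)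
        halve (inj₂ (e , p)) = e , hits-neg {base e} (hits-double e (+ h) attains-2 (complement p))

  O X X⁻ 2X : Form
  O  = 0ℤ , 0ℤ
  X  = 1ℤ , 0ℤ
  X⁻ = -1ℤ , 0ℤ
  2X = + 2 , 0ℤ

  -- The lifts in these cycles were found by computer search.
  cycle₄ : Fin 4 → Symbol
  cycle₄ = lookup ((O , + 0) ∷ (X , + 0) ∷ (O , + 1) ∷ (X , + 2) ∷ [])

  -- As in the other odd cycles, the forms alternate between 0 and r and climb to 2r at the end: the
  -- k - 1 single steps have signs adding up to 2, and the closing step -2r compensates.
  cycle₅ : Fin 5 → Symbol
  cycle₅ = lookup ((O , + 0) ∷ (X , + 0) ∷ (O , + 2) ∷ (X , + 1) ∷ (2X , + 2) ∷ [])

  cycle₇ : Fin 7 → Symbol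
  cycle₇ = lookup ((O , + 0) ∷ (X , + 0) ∷ (O , + 1) ∷ (X , + 2) ∷ (O , + 4) ∷ (X , + 1) ∷ (2X , + 3) ∷ [])

  cycle₈ : Fin 8 → Symbol
  cycle₈ = lookup ((O , + 0) ∷ (X , + 0) ∷ (O , + 1) ∷ (X , + 2) ∷ (O , + 4) ∷ (X , + 1) ∷ (O , + 6) ∷ (X⁻ , + 4) ∷ [])

  cycle₉ : Fin 9 → Symbol
  cycle₉ = lookup ((O , + 0) ∷ (X , + 0) ∷ (O , + 1) ∷ (X , + 4) ∷ (O , + 3) ∷ (X , + 1) ∷ (O , + 5) ∷ (X , + 7) ∷ (2X , + 4) ∷ [])

  separated! : ∀ {k} nonzero (p : Fin k → Symbol) → {True (separated? nonzero p)} → Separated nonzero p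
  separated! nonzero p {t} = toWitness t

  module _ (n : ℕ) .{{_ : NonZero (2 ℕ.* n ℕ.+ 1)}} where

    baseCycles₄ : ∃ (CyclicSystem.BaseCycles n 4)
    baseCycles₄ = base , even-baseCycles (toWitness {a? = all? λ j → attains? cycle₄ X (+ toℕ j)} _)
      where open OneClass n 4 cycle₄ (separated! x-axis cycle₄) (separated! x-axis (symbolicMidpoint cycle₄))

    baseCycles₈ : ∃ (CyclicSystem.BaseCycles n 8)
    baseCycles₈ = base , even-baseCycles (toWitness {a? = all? λ j → attains? cycle₈ X (+ toℕ j)} _)
      where open OneClass n 8 cycle₈ (separated! x-axis cycle₈) (separated! x-axis (symbolicMidpoint cycle₈))

    baseCycles₅ : ∃ (CyclicSystem.BaseCycles n 5)
    baseCycles₅ = base , odd-baseCycles 2 refl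
      (toWitness {a? = all? λ j → (toℕ j ℕ.≟ 2) ⊎-dec attains? cycle₅ X (+ toℕ j)} _)
      (toWitness {a? = attains? cycle₅ 2X (+ 2)} _)
      where open OneClass n 5 cycle₅ (separated! x-axis cycle₅) (separated! x-axis (symbolicMidpoint cycle₅))

    baseCycles₇ : ∃ (CyclicSystem.BaseCycles n 7)
    baseCycles₇ = base , odd-baseCycles 3 refl
      (toWitness {a? = all? λ j → (toℕ j ℕ.≟ 3) ⊎-dec attains? cycle₇ X (+ toℕ j)} _)
      (toWitness {a? = attains? cycle₇ 2X (+ 3)} _)
      where open OneClass n 7 cycle₇ (separated! x-axis cycle₇) (separated! x-axis (symbolicMidpoint cycle₇))

    baseCycles₉ : ∃ (CyclicSystem.BaseCycles n 9)
    baseCycles₉ = base , odd-baseCycles 4 refl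
      (toWitness {a? = all? λ j → (toℕ j ℕ.≟ 4) ⊎-dec attains? cycle₉ X (+ toℕ j)} _)
      (toWitness {a? = attains? cycle₉ 2X (+ 4)} _)
      where open OneClass n 9 cycle₉ (separated! x-axis cycle₉) (separated! x-axis (symbolicMidpoint cycle₉))

  -- Cycles within two classes: k = 6.

  module PairedClasses (m : ℕ) .{{_ : NonZero (2 ℕ.* (m ℕ.* 2) ℕ.+ 1)}} where

    open CyclicSystem (m ℕ.* 2) 6
    open Templates (m ℕ.* 2) 6

    Y : Form
    Y = 0ℤ , 1ℤ

    axes : List Form
    axes = X ∷ X⁻ ∷ Y ∷ negate Y ∷ (1ℤ , -1ℤ) ∷ (-1ℤ , 1ℤ) ∷ []

    -- The first cycle uses four steps of class r and two of class s, the second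
    -- cycle uses the remaining two and four.
    cycle₆ : Fin 2 → Fin 6 → Symbol
    cycle₆ zero       = lookup ((O , + 0) ∷ (X , + 0) ∷ (O , + 1) ∷ (X , + 3) ∷ (O , + 2) ∷ (Y , + 0) ∷ [])
    cycle₆ (suc zero) = lookup ((O , + 0) ∷ (Y , + 1) ∷ (O , + 2) ∷ (Y , + 4) ∷ (O , + 1) ∷ (X , + 4) ∷ [])

    vertices : ∀ b → Separated axes (cycle₆ b)
    vertices = toWitness {a? = all? λ b → separated? axes (cycle₆ b)} _

    midpoints : ∀ b → Separated axes (symbolicMidpoint (cycle₆ b))
    midpoints = toWitness {a? = all? λ b → separated? axes (symbolicMidpoint (cycle₆ b))} _

    attains-X : ∀ (j : Fin 6) → ∃ λ b → Attains (cycle₆ b) X (+ toℕ j)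
    attains-X = toWitness {a? = all? λ j → any? λ b → attains? (cycle₆ b) X (+ toℕ j)} _

    attains-Y : ∀ (j : Fin 6) → ∃ λ b → Attains (cycle₆ b) Y (+ toℕ j)
    attains-Y = toWitness {a? = all? λ j → any? λ b → attains? (cycle₆ b) Y (+ toℕ j)} _

    -- Pairing consecutive classes makes r - s = -1, so the mixed forms in `axes` are never
    -- multiples of q.
    r s : Fin m → ℕ
    r i = ℕ.suc (2 ℕ.* toℕ i)
    s i = ℕ.suc (r i)

    base′ : Fin m × Fin 2 → Fin 6 → ℤ
    base′ (i , b) = eval (+ r i) (+ s i) ∘ cycle₆ b

    base : Fin (m ℕ.* 2) → Fin 6 → ℤ
    base = base′ ∘ remQuot 2

    s<q : ∀ i → s i ℕ.< q
    s<q i = begin-strict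
      s i                        ≡⟨ eq (toℕ i) ⟩
      ℕ.suc (toℕ i) ℕ.* 2        ≤⟨ ℕ.*-monoˡ-≤ 2 (toℕ<n i) ⟩
      m ℕ.* 2                    <⟨ ℕ.s≤s (ℕ.m≤m+n (m ℕ.* 2) (m ℕ.* 2)) ⟩
      ℕ.suc (m ℕ.* 2 ℕ.+ m ℕ.* 2) ≡⟨ eq′ (m ℕ.* 2) ⟩
      q                          ∎
      where
      open ℕ.≤-Reasoning
      eq : ∀ i → ℕ.suc (ℕ.suc (2 ℕ.* i)) ≡ ℕ.suc i ℕ.* 2
      eq = ℕ-Solver.solve-∀
      eq′ : ∀ n → ℕ.suc (n ℕ.+ n) ≡ 2 ℕ.* n ℕ.+ 1
      eq′ = ℕ-Solver.solve-∀

    q∤axes : ∀ i → All (λ f → ¬ + q ∣ evalForm (+ r i) (+ s i) f) axes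
    q∤axes i =
      (λ h → bounded∤ (+ r i) ℕ.z<s r<q (h ∣-via eq₁ (+ r i) (+ s i))) ∷
      (λ h → bounded∤ (+ r i) ℕ.z<s r<q (∣m⇒∣-m h ∣-via eq₂ (+ r i) (+ s i))) ∷
      (λ h → bounded∤ (+ s i) ℕ.z<s (s<q i) (h ∣-via eq₃ (+ r i) (+ s i))) ∷
      (λ h → bounded∤ (+ s i) ℕ.z<s (s<q i) (∣m⇒∣-m h ∣-via eq₄ (+ r i) (+ s i))) ∷
      (λ h → bounded∤ 1ℤ ℕ.z<s 1<q (∣m⇒∣-m h ∣-via eq₅ (+ r i))) ∷
      (λ h → bounded∤ 1ℤ ℕ.z<s 1<q (h ∣-via eq₆ (+ r i))) ∷ []
      where
      r<q : r i ℕ.< q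
      r<q = ℕ.<-trans (ℕ.n<1+n (r i)) (s<q i)
      1<q : 1 ℕ.< q
      1<q = ℕ.≤-<-trans (ℕ.s≤s ℕ.z≤n) (s<q i)
      eq₁ : ∀ r s → 1ℤ * r + 0ℤ * s ≡ r
      eq₁ = solve-∀
      eq₂ : ∀ r s → - (-1ℤ * r + 0ℤ * s) ≡ r
      eq₂ = solve-∀
      eq₃ : ∀ r s → 0ℤ * r + 1ℤ * s ≡ s
      eq₃ = solve-∀
      eq₄ : ∀ r s → - (0ℤ * r + -1ℤ * s) ≡ s
      eq₄ = solve-∀
      eq₅ : ∀ r → - (1ℤ * r + -1ℤ * (1ℤ + r)) ≡ 1ℤ
      eq₅ = solve-∀
      eq₆ : ∀ r → -1ℤ * r + 1ℤ * (1ℤ + r) ≡ 1ℤ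
      eq₆ = solve-∀

    hit : ∀ i (f : Form) (j : Fin 6) {δ} → (∃ λ b → Attains (cycle₆ b) f (+ toℕ j)) →
      δ ≡ evalForm (+ r i) (+ s i) f + + toℕ j * + q [mod v ] → ∃ λ d → Hits (base d) δ
    hit i f j {δ} (b , a) δ≡ = combine i b ,
      subst (λ ib → Hits (base′ ib) δ) (sym (remQuot-combine i b)) (attains⇒hits (+ r i) (+ s i) {cycle₆ b} a δ≡)

    cover : ∀ (ib : Fin m × Fin 2) (j : Fin 6) {δ} →
      δ ≡ + ℕ.suc (2 ℕ.* toℕ (proj₁ ib) ℕ.+ toℕ (proj₂ ib)) + + toℕ j * + q [mod v ] → ∃ λ d → Hits (base d) δ
    cover (i , zero) j δ≡ = hit i X j (attains-X j) (≡mod-trans δ≡ (≡mod-reflexive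
      (trans (cong (λ z → + ℕ.suc z + + toℕ j * + q) (ℕ.+-identityʳ (2 ℕ.* toℕ i))) (eq (+ r i) (+ s i) (+ toℕ j * + q)))))
      where eq : ∀ r s jq → r + jq ≡ 1ℤ * r + 0ℤ * s + jq
            eq = solve-∀
    cover (i , suc zero) j δ≡ = hit i Y j (attains-Y j) (≡mod-trans δ≡ (≡mod-reflexive
      (trans (cong (λ z → + ℕ.suc z + + toℕ j * + q) (ℕ.+-comm (2 ℕ.* toℕ i) 1)) (eq (+ r i) (+ s i) (+ toℕ j * + q)))))
      where eq : ∀ r s jq → s + jq ≡ 0ℤ * r + 1ℤ * s + jq
            eq = solve-∀

    baseCycles : BaseCycles base
    baseCycles = record
      { vertices-distinct  = λ d → let i , b = remQuot 2 d in
          separated⇒distinct (+ r i) (+ s i) (q∤axes i) {cycle₆ b} (vertices b)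
      ; midpoints-distinct = λ d → let i , b = remQuot 2 d in
          midpoints-separated⇒distinct (+ r i) (+ s i) (q∤axes i) {cycle₆ b} (midpoints b)
      ; covers = covers-by-cosets {base} λ d j {δ} δ≡ → cover (remQuot 2 d) j
          (subst (λ t → δ ≡ + ℕ.suc t + + toℕ j * + q [mod v ]) (toℕ-remQuot d) δ≡)
      }
      where
      toℕ-remQuot : ∀ (d : Fin (m ℕ.* 2)) → toℕ d ≡ 2 ℕ.* toℕ (proj₁ (remQuot {m} 2 d)) ℕ.+ toℕ (proj₂ (remQuot {m} 2 d))
      toℕ-remQuot d = trans (cong toℕ (sym (combine-remQuot {m} 2 d))) (toℕ-combine (proj₁ (remQuot {m} 2 d)) (proj₂ (remQuot {m} 2 d)))

  -- Triangles: k = 3.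

  odd-nonZero : ∀ n → NonZero (2 ℕ.* n ℕ.+ 1)
  odd-nonZero n = subst NonZero (ℕ.+-comm 1 (2 ℕ.* n)) _

  -- Any two distinct positions of a triangle are adjacent.
  ≡mod-3-injective : ∀ {m} (f : Fin 3 → ℤ) → (∀ i → ¬ f i ≡ f (next i) [mod m ]) →
    ∀ {i j} → f i ≡ f j [mod m ] → i ≡ j
  ≡mod-3-injective f apart {zero}           {zero}           p = refl
  ≡mod-3-injective f apart {zero}           {suc zero}       p = contradiction p (apart zero)
  ≡mod-3-injective f apart {zero}           {suc (suc zero)} p = contradiction (≡mod-sym p) (apart (suc (suc zero)))
  ≡mod-3-injective f apart {suc zero}       {zero}           p = contradiction (≡mod-sym p) (apart zero)
  ≡mod-3-injective f apart {suc zero}       {suc zero}       p = refl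
  ≡mod-3-injective f apart {suc zero}       {suc (suc zero)} p = contradiction p (apart (suc zero))
  ≡mod-3-injective f apart {suc (suc zero)} {zero}           p = contradiction p (apart (suc (suc zero)))
  ≡mod-3-injective f apart {suc (suc zero)} {suc zero}       p = contradiction (≡mod-sym p) (apart (suc zero))
  ≡mod-3-injective f apart {suc (suc zero)} {suc (suc zero)} p = refl

  module Triangles (n : ℕ) .{{_ : NonZero (2 ℕ.* n ℕ.+ 1)}} where

    open CyclicSystem n 3

    -- Adjacent vertices differ by a step, which is not a multiple of q. The sums x + y and y + z of
    -- two adjacent edges differ by x - z, again a step up to sign.
    triangle-baseCycles : ∀ {c} → Covers c → BaseCycles c
    triangle-baseCycles {c} covers = record
      { vertices-distinct  = λ r → ≡mod-3-injective (c r) (c-apart r)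
      ; midpoints-distinct = λ r → ≡mod-3-injective (midpoint (c r)) (midpoints-apart r)
      ; covers             = covers
      }
      where
      open Counting {c} covers
      c-apart : ∀ r i → ¬ c r i ≡ c r (next i) [mod v ]
      c-apart r i p = q∤step r i (∣-trans q∣v (difference (≡mod-sym p)))
      cancel : ∀ {x y z} → x + y ≡ y + z [mod v ] → x ≡ z [mod v ]
      cancel {x} {y} {z} (congruent p) = congruent (p ∣-via eq x y z)
        where eq : ∀ x y z → x + y - (y + z) ≡ x - z
              eq = solve-∀
      midpoints-apart : ∀ r i → ¬ midpoint (c r) i ≡ midpoint (c r) (next i) [mod v ]
      midpoints-apart r zero             p = c-apart r (suc (suc zero)) (≡mod-sym (cancel {c r zero} {c r (suc zero)} p))
      midpoints-apart r (suc zero)       p = c-apart r zero (≡mod-sym (cancel {c r (suc zero)} {c r (suc (suc zero))} p))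
      midpoints-apart r (suc (suc zero)) p = c-apart r (suc zero) (≡mod-sym (cancel {c r (suc (suc zero))} {c r zero} p))

    module Bose (3∣q²-1 : + 3 ∣ + q * + q - 1ℤ) where

      -- Under ℤ/3q ≅ ℤ/q × ℤ/3 this is the triangle (-x, 0), (x, 0), (0, ±1) with x = 3(d + 1)
      -- modulo q. One edge is a pure difference, the other two are mixed.
      bose : Fin n → Fin 3 → ℤ
      bose d = lookup (- (+ 3 * + ℕ.suc (toℕ d)) ∷ + 3 * + ℕ.suc (toℕ d) ∷ + q ∷ [])

      private
        *3-≡mod : ∀ {x y} → x ≡ y [mod + q ] → + 3 * x ≡ + 3 * y [mod v ]
        *3-≡mod {x} {y} (congruent (divides t e)) = congruent (divides t (trans (eq x y) (trans (cong (+ 3 *_) e) (eq′ t (+ q)))))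
          where eq : ∀ x y → + 3 * x - + 3 * y ≡ + 3 * (x - y)
                eq = solve-∀
                eq′ : ∀ t q → + 3 * (t * q) ≡ t * (q * + 3)
                eq′ = solve-∀

        q∤⇒q∤ : ∀ {x y} → ¬ + q ∣ y → y ≡ + 3 * x [mod + q ] → ¬ + q ∣ x
        q∤⇒q∤ q∤y y≡3x q∣x = q∤y (∣-resp-≡mod (≡mod-sym y≡3x) (∣n⇒∣m*n (+ 3) q∣x))

        pure : ∀ {δ y} → ¬ + q ∣ δ → δ ≡ + 3 * y [mod v ] → ∃ λ d → Hits (bose d) δ
        pure {δ} {y} q∤δ δ≡ = go (±residue n h q∤h)
          where
          -- The first edge has step 6(d + 1), so 3y has to be halved. The inverse of 2 modulo q =
          -- 2n + 1 is n + 1.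
          h = y * (1ℤ + + n)
          2h≡y : + 2 * h ≡ y [mod + q ]
          2h≡y = congruent (divides y (trans (eq y (+ n)) (cong (λ z → y * (z + 1ℤ)) (sym (ℤ.pos-* 2 n)))))
            where eq : ∀ y n → + 2 * (y * (1ℤ + n)) - y ≡ y * (+ 2 * n + 1ℤ)
                  eq = solve-∀
          q∤h : ¬ + q ∣ h
          q∤h q∣h = q∤⇒q∤ q∤δ (congruent (∣-trans q∣v (difference δ≡)))
            (∣-resp-≡mod 2h≡y (∣n⇒∣m*n (+ 2) q∣h))
          double : ∀ {x} → h ≡ x [mod + q ] → y ≡ x + x [mod + q ]
          double {x} p = ≡mod-trans (≡mod-sym 2h≡y) (≡mod-trans (≡mod-reflexive (eq h)) (+-≡mod p p))
            where eq : ∀ h → + 2 * h ≡ h + h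
                  eq = solve-∀
          go : _ → ∃ λ d → Hits (bose d) δ
          go (d , inj₁ p) = d , zero , inj₁ (≡mod-trans δ≡
            (≡mod-trans (*3-≡mod (double p)) (≡mod-reflexive (eq (+ ℕ.suc (toℕ d))))))
            where eq : ∀ r → + 3 * (r + r) ≡ + 3 * r - - (+ 3 * r)
                  eq = solve-∀
          go (d , inj₂ p) = d , zero , inj₂ (≡mod-trans δ≡
            (≡mod-trans (*3-≡mod (double p)) (≡mod-reflexive (eq (+ ℕ.suc (toℕ d))))))
            where eq : ∀ r → + 3 * (- r + - r) ≡ - (+ 3 * r - - (+ 3 * r))
                  eq = solve-∀

        mixed : ∀ {δ y} → ¬ + q ∣ δ → δ ≡ + q + + 3 * y [mod v ] → ∃ λ d → Hits (bose d) δ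
        mixed {δ} {y} q∤δ δ≡ = go (±residue n y (q∤⇒q∤ q∤δ
          (≡mod-trans (congruent (∣-trans q∣v (difference δ≡))) (congruent (divides 1ℤ (eq (+ q) (+ 3 * y)))))))
          where
          eq : ∀ q x → q + x - x ≡ 1ℤ * q
          eq = solve-∀
          go : _ → ∃ λ d → Hits (bose d) δ
          go (d , inj₁ p) = d , suc (suc zero) , inj₂ (≡mod-trans δ≡
            (≡mod-trans (+-≡mod (≡mod-refl {x = + q}) (*3-≡mod p)) (≡mod-reflexive (eq₁ (+ q) (+ ℕ.suc (toℕ d))))))
            where eq₁ : ∀ q r → q + + 3 * r ≡ - (- (+ 3 * r) - q)
                  eq₁ = solve-∀
          go (d , inj₂ p) = d , suc zero , inj₁ (≡mod-trans δ≡
            (≡mod-trans (+-≡mod (≡mod-refl {x = + q}) (*3-≡mod p)) (≡mod-reflexive (eq₂ (+ q) (+ ℕ.suc (toℕ d))))))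
            where eq₂ : ∀ q r → q + + 3 * - r ≡ q - + 3 * r
                  eq₂ = solve-∀

      bose-covers : Covers bose
      bose-covers δ q∤δ = go (residue 3 (δ * + q)) δ≡wq
        where
        -- Since q² ≡ 1 modulo 3, q is its own inverse there, and w = δq solves δ ≡ wq.
        δ≡wq : δ ≡ + toℕ (residue 3 (δ * + q)) * + q [mod + 3 ]
        δ≡wq = ≡mod-trans (congruent (∣m⇒∣-m (∣n⇒∣m*n δ 3∣q²-1) ∣-via eq δ (+ q)))
          (congruent (∣m⇒∣m*n (+ q) (difference (residue-≡mod 3 (δ * + q))) ∣-via eq′ (δ * + q) (+ toℕ (residue 3 (δ * + q))) (+ q)))
          where eq : ∀ δ q → - (δ * (q * q - 1ℤ)) ≡ δ - δ * q * q
                eq = solve-∀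
                eq′ : ∀ x w q → (x - w) * q ≡ x * q - w * q
                eq′ = solve-∀
        go : ∀ (w : Fin 3) → δ ≡ + toℕ w * + q [mod + 3 ] → ∃ λ d → Hits (bose d) δ
        go zero (congruent (divides y e)) = pure {y = y} q∤δ (≡mod-reflexive (trans (eq δ (+ q)) (trans e (ℤ.*-comm y (+ 3)))))
          where eq : ∀ δ q → δ ≡ δ - 0ℤ * q
                eq = solve-∀
        go (suc zero) (congruent (divides y e)) = mixed {y = y} q∤δ (≡mod-reflexive
          (trans (eq δ (+ q)) (cong (λ z → + q + z) (trans e (ℤ.*-comm y (+ 3))))))
          where eq : ∀ δ q → δ ≡ q + (δ - 1ℤ * q)
                eq = solve-∀
        -- Negation turns 2q into -2q = q - 3q, so -δ falls under the mixed case.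
        go (suc (suc zero)) (congruent (divides y e)) =
          let d , h = mixed {y = - (y + + q)} (λ q∣-δ → q∤δ (∣m⇒∣-m q∣-δ ∣-via ℤ.neg-involutive δ))
                (≡mod-reflexive (trans (eq δ (+ q)) (trans (cong (λ z → - + 2 * + q - z) e) (eq′ y (+ q)))))
          in d , Templates.hits-neg n 3 {bose d} h
          where eq : ∀ δ q → - δ ≡ - + 2 * q - (δ - + 2 * q)
                eq = solve-∀
                eq′ : ∀ y q → - + 2 * q - y * + 3 ≡ q + + 3 * - (y + q)
                eq′ = solve-∀

      boseBaseCycles : BaseCycles bose
      boseBaseCycles = triangle-baseCycles bose-covers

    triangle : ℕ × ℕ → Fin 3 → ℤ
    triangle (a , c) = lookup (0ℤ ∷ + a ∷ + c ∷ [])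

    -- The triangle 0, a, c has the differences a, c - a and ±c. The last alternative serves the `c`
    -- that exceed half of 3q; sums replace differences to avoid truncated subtraction.
    Catches : ℕ → ℕ × ℕ → Set
    Catches e (a , c) = e ≡ a ⊎ e ℕ.+ a ≡ c ⊎ e ≡ c ⊎ e ℕ.+ c ≡ q ℕ.* 3

    catches? : ∀ e ac → Dec (Catches e ac)
    catches? e (a , c) = (e ℕ.≟ a) ⊎-dec (e ℕ.+ a ℕ.≟ c) ⊎-dec (e ℕ.≟ c) ⊎-dec (e ℕ.+ c ℕ.≟ q ℕ.* 3)

    catches⇒hits : ∀ {e ac δ} → Catches e ac → δ ≡ + e [mod v ] → Hits (triangle ac) δ
    catches⇒hits {e} {a , c} (inj₁ refl) δ≡ = zero , inj₁ (≡mod-trans δ≡ (≡mod-reflexive (sym (ℤ.+-identityʳ (+ e)))))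
    catches⇒hits {e} {a , c} (inj₂ (inj₁ refl)) δ≡ = suc zero , inj₁ (≡mod-trans δ≡ (≡mod-reflexive (eq (+ e) (+ a))))
      where eq : ∀ e a → e ≡ e + a - a
            eq = solve-∀
    catches⇒hits {e} {a , c} (inj₂ (inj₂ (inj₁ refl))) δ≡ = suc (suc zero) , inj₂ (≡mod-trans δ≡ (≡mod-reflexive (eq (+ e))))
      where eq : ∀ e → e ≡ - (0ℤ - e)
            eq = solve-∀
    catches⇒hits {e} {a , c} (inj₂ (inj₂ (inj₂ e+c≡v))) δ≡ = suc (suc zero) , inj₁ (≡mod-trans δ≡ (congruent (divides 1ℤ
      (trans (eq (+ e) (+ c)) (trans (cong +_ e+c≡v) (trans (ℤ.pos-* q 3) (sym (ℤ.*-identityˡ v))))))))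
      where eq : ∀ e c → e - (0ℤ - c) ≡ e + c
            eq = solve-∀

    triangles-baseCycles : (L : List (ℕ × ℕ)) → length L ≡ n →
      (∀ e → 1 ℕ.≤ e → e ℕ.< 3 ℕ.* n ℕ.+ 2 → e ≡ q ⊎ Any (Catches e) L) → ∃ BaseCycles
    triangles-baseCycles L refl catch = triangle ∘ List.lookup L , triangle-baseCycles covers
      where
      -- This is (v - 1)/2: as v = 3q is odd, every difference is congruent to ±e for some e ≤ N,
      -- and checking those e is enough.
      N = 3 ℕ.* n ℕ.+ 1
      instance
        modulus-nonZero : NonZero (2 ℕ.* N ℕ.+ 1)
        modulus-nonZero = odd-nonZero N
      modulus : + (2 ℕ.* N ℕ.+ 1) ≡ v
      modulus = trans (cong +_ (eq n)) (ℤ.pos-* q 3)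
        where eq : ∀ n → 2 ℕ.* (3 ℕ.* n ℕ.+ 1) ℕ.+ 1 ≡ (2 ℕ.* n ℕ.+ 1) ℕ.* 3
              eq = ℕ-Solver.solve-∀
      positive : ∀ {δ} (d : Fin N) → ¬ + q ∣ δ → δ ≡ + ℕ.suc (toℕ d) [mod v ] → ∃ λ r → Hits (triangle (List.lookup L r)) δ
      positive {δ} d q∤δ δ≡ = found (catch (ℕ.suc (toℕ d)) (ℕ.s≤s ℕ.z≤n)
        (ℕ.≤-<-trans (toℕ<n d) (ℕ.+-monoʳ-< (3 ℕ.* n) (ℕ.n<1+n 1))))
        where
        found : _ → _
        found (inj₁ e≡q) = contradiction
          (∣-resp-≡mod (≡mod-sym (congruent (∣-trans q∣v (difference δ≡))))
            (divides 1ℤ (trans (cong +_ e≡q) (sym (ℤ.*-identityˡ (+ q)))))) q∤δ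
        found (inj₂ any) = Any.index any , catches⇒hits {ac = List.lookup L (Any.index any)} (Any.lookup-index any) δ≡
      covers : Covers (triangle ∘ List.lookup L)
      covers δ q∤δ = signed (±residue N δ λ N∣δ → q∤δ (∣-trans q∣v (subst (_∣ δ) modulus N∣δ)))
        where
        signed : _ → ∃ λ r → Hits (triangle (List.lookup L r)) δ
        signed (d , inj₁ p) = positive d q∤δ (subst (λ m → δ ≡ + ℕ.suc (toℕ d) [mod m ]) modulus p)
        signed (d , inj₂ p) =
          let r , h = positive d (λ q∣-δ → q∤δ (∣m⇒∣-m q∣-δ ∣-via ℤ.neg-involutive δ))
                (≡mod-trans (-‿≡mod (subst (λ m → δ ≡ - + ℕ.suc (toℕ d) [mod m ]) modulus p))
                  (≡mod-reflexive (ℤ.neg-involutive (+ ℕ.suc (toℕ d)))))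
          in r , Templates.hits-neg n 3 {triangle (List.lookup L r)} h

  -- Covering intervals of natural numbers.

  module _ (P : ℕ → Set) where

    Covered : ℕ → ℕ → Set
    Covered a b = ∀ e → a ℕ.≤ e → e ℕ.< b → P e

  module _ {P : ℕ → Set} where

    covered-trans : ∀ {a b c} → Covered P a b → Covered P b c → Covered P a c
    covered-trans {b = b} f g e a≤e e<c with e ℕ.<? b
    ... | yes e<b = f e a≤e e<b
    ... | no  e≮b = g e (ℕ.≮⇒≥ e≮b) e<c

    covered-single : ∀ {a} → P a → Covered P a (ℕ.suc a)
    covered-single p e a≤e e<1+a = subst P (ℕ.≤-antisym a≤e (ℕ.s≤s⁻¹ e<1+a)) p

    covered-by-offset : ∀ {a b} N → a ℕ.+ N ≡ b → (∀ j → j ℕ.< N → P (a ℕ.+ j)) → Covered P a b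
    covered-by-offset {a} N refl f e a≤e e<a+N = subst P (ℕ.m+[n∸m]≡n a≤e) (f (e ℕ.∸ a)
      (ℕ.+-cancelˡ-< a (e ℕ.∸ a) N (subst (ℕ._< a ℕ.+ N) (sym (ℕ.m+[n∸m]≡n a≤e)) e<a+N)))

    -- For values that fall as the index grows: the value at offset `j` from the bottom has index
    -- `i` with i + 1 + j = N. Keeping this as an equation lets callers rewrite the sum and never
    -- meet a subtraction.
    covered-descending : ∀ {a b} N → a ℕ.+ N ≡ b → (∀ i j → i ℕ.< N → ℕ.suc (i ℕ.+ j) ≡ N → P (a ℕ.+ j)) → Covered P a b
    covered-descending N a+N≡b f = covered-by-offset N a+N≡b λ j j<N →
      f (N ℕ.∸ ℕ.suc j) j (subst (N ℕ.∸ ℕ.suc j ℕ.<_) (i+1+j≡N j<N) (ℕ.s≤s (ℕ.m≤m+n _ j))) (i+1+j≡N j<N)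
      where
      i+1+j≡N : ∀ {j} → j ℕ.< N → ℕ.suc (N ℕ.∸ ℕ.suc j ℕ.+ j) ≡ N
      i+1+j≡N {j} j<N = trans (sym (ℕ.+-suc (N ℕ.∸ ℕ.suc j) j)) (ℕ.m∸n+n≡m j<N)

    covered-period : ∀ {a b} p .{{_ : NonZero p}} N → a ℕ.+ N ℕ.* p ≡ b →
      (∀ (r : Fin p) i → i ℕ.< N → P (a ℕ.+ (toℕ r ℕ.+ i ℕ.* p))) → Covered P a b
    covered-period {a} p N a+Np≡b f = covered-by-offset (N ℕ.* p) a+Np≡b λ j j<Np →
      subst (λ j → P (a ℕ.+ j)) (sym (trans (ℕ.m≡m%n+[m/n]*n j p)
        (cong (ℕ._+ j ℕ./ p ℕ.* p) (sym (toℕ-fromℕ< (ℕ.m%n<n j p))))))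
        (f (fromℕ< (ℕ.m%n<n j p)) (j ℕ./ p) (ℕ.m<n*o⇒m/o<n j<Np))

  -- With `above-zero`, this attaches sporadic triples to the ends of a progression coming from an
  -- infinite family.
  below-suc : ∀ {P : ℕ → Set} {N} → (∀ i → i ℕ.< N → P i) → P N → ∀ i → i ℕ.< ℕ.suc N → P i
  below-suc {P} {N} f p i i<1+N with ℕ.m<1+n⇒m<n∨m≡n i<1+N
  ... | inj₁ i<N = f i i<N
  ... | inj₂ refl = p

  above-zero : ∀ {P : ℕ → Set} {N} → P 0 → (∀ i → i ℕ.< N → P (ℕ.suc i)) → ∀ i → i ℕ.< ℕ.suc N → P i
  above-zero p f ℕ.zero    _     = p
  above-zero p f (ℕ.suc i) i+1<N = f i (ℕ.s≤s⁻¹ i+1<N)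

  -- Difference triples when 3 divides q.

  -- Peltesohn's triples (a, c - a, c) for v = 18s + 9, with s = t + 4.
  module Peltesohn (t : ℕ) where

    n : ℕ
    -- In this form it is what `1 + (4 + t) * 3` reduces to, as the final case split requires.
    n = 13 ℕ.+ t ℕ.* 3

    instance
      q-nonZero : NonZero (2 ℕ.* n ℕ.+ 1)
      q-nonZero = odd-nonZero n

    open Triangles n

    -- The middle differences c - a are 19 + 4t - i, 32 + 8t - i and 23 + 6t - 2i. The values `a` of
    -- the three families lie in the three residue classes modulo 3. The even values `c` of
    -- `family₁` interleave with the odd middle differences of `family₃`; the remaining differences
    -- form runs or, for the `c` of `family₂`, pair with their own negatives.
    family₁ family₂ family₃ : ℕ → ℕ × ℕ
    family₁ i = 1 ℕ.+ 3 ℕ.* i , 20 ℕ.+ 4 ℕ.* t ℕ.+ 2 ℕ.* i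
    family₂ i = 8 ℕ.+ 3 ℕ.* i , 40 ℕ.+ 8 ℕ.* t ℕ.+ 2 ℕ.* i
    family₃ i = 6 ℕ.+ 3 ℕ.* i , 29 ℕ.+ 6 ℕ.* t ℕ.+ i

    sporadic families triples : List (ℕ × ℕ)
    sporadic =
      (2 , 37 ℕ.+ 8 ℕ.* t) ∷
      (3 , 36 ℕ.+ 8 ℕ.* t) ∷
      (5 , 39 ℕ.+ 8 ℕ.* t) ∷
      (11 ℕ.+ 3 ℕ.* t , 25 ℕ.+ 6 ℕ.* t) ∷
      (12 ℕ.+ 3 ℕ.* t , 43 ℕ.+ 10 ℕ.* t) ∷ []
    families = applyUpTo family₁ (5 ℕ.+ t) ++ applyUpTo family₂ (1 ℕ.+ t) ++ applyUpTo family₃ (2 ℕ.+ t)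
    triples = sporadic ++ families

    length-triples : length triples ≡ n
    length-triples = cong (5 ℕ.+_) (begin
      length families
        ≡⟨ List.length-++ (applyUpTo family₁ (5 ℕ.+ t)) ⟩
      length (applyUpTo family₁ (5 ℕ.+ t)) ℕ.+ length (applyUpTo family₂ (1 ℕ.+ t) ++ applyUpTo family₃ (2 ℕ.+ t))
        ≡⟨ cong₂ ℕ._+_ (List.length-applyUpTo family₁ (5 ℕ.+ t)) (trans (List.length-++ (applyUpTo family₂ (1 ℕ.+ t)))
             (cong₂ ℕ._+_ (List.length-applyUpTo family₂ (1 ℕ.+ t)) (List.length-applyUpTo family₃ (2 ℕ.+ t)))) ⟩
      5 ℕ.+ t ℕ.+ (1 ℕ.+ t ℕ.+ (2 ℕ.+ t))
        ≡⟨ eq t ⟩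
      8 ℕ.+ t ℕ.* 3 ∎)
      where
      open ≡-Reasoning
      eq : ∀ t → 5 ℕ.+ t ℕ.+ (1 ℕ.+ t ℕ.+ (2 ℕ.+ t)) ≡ 8 ℕ.+ t ℕ.* 3
      eq = ℕ-Solver.solve-∀

    Caught : ℕ → Set
    Caught e = e ≡ 2 ℕ.* n ℕ.+ 1 ⊎ Any (Catches e) triples

    at₁ : ∀ {e i} → i ℕ.< 5 ℕ.+ t → Catches e (family₁ i) → Caught e
    at₁ i< c = inj₂ (Any.++⁺ʳ sporadic (Any.++⁺ˡ (Any.applyUpTo⁺ family₁ c i<)))

    at₂ : ∀ {e i} → i ℕ.< 1 ℕ.+ t → Catches e (family₂ i) → Caught e
    at₂ i< c = inj₂ (Any.++⁺ʳ sporadic (Any.++⁺ʳ (applyUpTo family₁ (5 ℕ.+ t)) (Any.++⁺ˡ (Any.applyUpTo⁺ family₂ c i<))))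

    at₃ : ∀ {e i} → i ℕ.< 2 ℕ.+ t → Catches e (family₃ i) → Caught e
    at₃ i< c = inj₂ (Any.++⁺ʳ sporadic (Any.++⁺ʳ (applyUpTo family₁ (5 ℕ.+ t))
      (Any.++⁺ʳ (applyUpTo family₂ (1 ℕ.+ t)) (Any.applyUpTo⁺ family₃ c i<))))

    is-a : ∀ {e a c} → e ≡ a → Catches e (a , c)
    is-a = inj₁

    is-b : ∀ {e a c} → e ℕ.+ a ≡ c → Catches e (a , c)
    is-b = inj₂ ∘ inj₁

    is-c : ∀ {e a c} → e ≡ c → Catches e (a , c)
    is-c = inj₂ ∘ inj₂ ∘ inj₁

    is--c : ∀ {e a c} → e ℕ.+ c ≡ (2 ℕ.* n ℕ.+ 1) ℕ.* 3 → Catches e (a , c)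
    is--c = inj₂ ∘ inj₂ ∘ inj₂

    covered₁ : Covered Caught 1 (13 ℕ.+ 3 ℕ.* t)
    covered₁ = covered-period 3 (4 ℕ.+ t) (eq t) cases
      where
      eq : ∀ t → 1 ℕ.+ (4 ℕ.+ t) ℕ.* 3 ≡ 13 ℕ.+ 3 ℕ.* t
      eq = ℕ-Solver.solve-∀
      eq₁ : ∀ i → 1 ℕ.+ i ℕ.* 3 ≡ 1 ℕ.+ 3 ℕ.* i
      eq₁ = ℕ-Solver.solve-∀
      eq₂ : ∀ i → 1 ℕ.+ (1 ℕ.+ (2 ℕ.+ i) ℕ.* 3) ≡ 8 ℕ.+ 3 ℕ.* i
      eq₂ = ℕ-Solver.solve-∀
      eq₃ : ∀ t → 1 ℕ.+ (1 ℕ.+ (3 ℕ.+ t) ℕ.* 3) ≡ 11 ℕ.+ 3 ℕ.* t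
      eq₃ = ℕ-Solver.solve-∀
      eq₄ : ∀ i → 1 ℕ.+ (2 ℕ.+ (1 ℕ.+ i) ℕ.* 3) ≡ 6 ℕ.+ 3 ℕ.* i
      eq₄ = ℕ-Solver.solve-∀
      eq₅ : ∀ t → 1 ℕ.+ (2 ℕ.+ (3 ℕ.+ t) ℕ.* 3) ≡ 12 ℕ.+ 3 ℕ.* t
      eq₅ = ℕ-Solver.solve-∀
      cases : ∀ (r : Fin 3) i → i ℕ.< 4 ℕ.+ t → Caught (1 ℕ.+ (toℕ r ℕ.+ i ℕ.* 3))
      cases zero i i< = at₁ (ℕ.m<n⇒m<1+n i<) (is-a (eq₁ i))
      cases (suc zero) = above-zero (inj₂ (here (is-a refl))) (above-zero (inj₂ (there (there (here (is-a refl)))))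
        (below-suc (λ i i< → at₂ i< (is-a (eq₂ i))) (inj₂ (there (there (there (here (is-a (eq₃ t)))))))))
      cases (suc (suc zero)) = above-zero (inj₂ (there (here (is-a refl))))
        (below-suc (λ i i< → at₃ i< (is-a (eq₄ i))) (inj₂ (there (there (there (there (here (is-a (eq₅ t)))))))))

    covered₂ : Covered Caught (13 ℕ.+ 3 ℕ.* t) (15 ℕ.+ 3 ℕ.* t)
    covered₂ = covered-trans (covered-single (at₁ (ℕ.n<1+n (4 ℕ.+ t)) (is-a (eq₁ t))))
      (covered-single (inj₂ (there (there (there (here (is-b (eq₂ t))))))))
      where
      eq₁ : ∀ t → 13 ℕ.+ 3 ℕ.* t ≡ 1 ℕ.+ 3 ℕ.* (4 ℕ.+ t)
      eq₁ = ℕ-Solver.solve-∀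
      eq₂ : ∀ t → 14 ℕ.+ 3 ℕ.* t ℕ.+ (11 ℕ.+ 3 ℕ.* t) ≡ 25 ℕ.+ 6 ℕ.* t
      eq₂ = ℕ-Solver.solve-∀

    covered₃ : Covered Caught (15 ℕ.+ 3 ℕ.* t) (20 ℕ.+ 4 ℕ.* t)
    covered₃ = covered-descending (5 ℕ.+ t) (eq t) λ i j i< i+j → at₁ i< (is-b
      (trans (eq₁ t i j) (trans (cong (λ z → 15 ℕ.+ 3 ℕ.* t ℕ.+ 2 ℕ.* i ℕ.+ z) i+j) (eq₂ t i))))
      where
      eq : ∀ t → 15 ℕ.+ 3 ℕ.* t ℕ.+ (5 ℕ.+ t) ≡ 20 ℕ.+ 4 ℕ.* t
      eq = ℕ-Solver.solve-∀
      eq₁ : ∀ t i j → 15 ℕ.+ 3 ℕ.* t ℕ.+ j ℕ.+ (1 ℕ.+ 3 ℕ.* i) ≡ 15 ℕ.+ 3 ℕ.* t ℕ.+ 2 ℕ.* i ℕ.+ ℕ.suc (i ℕ.+ j)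
      eq₁ = ℕ-Solver.solve-∀
      eq₂ : ∀ t i → 15 ℕ.+ 3 ℕ.* t ℕ.+ 2 ℕ.* i ℕ.+ (5 ℕ.+ t) ≡ 20 ℕ.+ 4 ℕ.* t ℕ.+ 2 ℕ.* i
      eq₂ = ℕ-Solver.solve-∀

    covered₄ : Covered Caught (20 ℕ.+ 4 ℕ.* t) (26 ℕ.+ 6 ℕ.* t)
    covered₄ = covered-period 2 (3 ℕ.+ t) (eq t) cases
      where
      eq : ∀ t → 20 ℕ.+ 4 ℕ.* t ℕ.+ (3 ℕ.+ t) ℕ.* 2 ≡ 26 ℕ.+ 6 ℕ.* t
      eq = ℕ-Solver.solve-∀
      eq₁ : ∀ t i → 20 ℕ.+ 4 ℕ.* t ℕ.+ i ℕ.* 2 ≡ 20 ℕ.+ 4 ℕ.* t ℕ.+ 2 ℕ.* i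
      eq₁ = ℕ-Solver.solve-∀
      eq₂ : ∀ t → 20 ℕ.+ 4 ℕ.* t ℕ.+ (1 ℕ.+ (2 ℕ.+ t) ℕ.* 2) ≡ 25 ℕ.+ 6 ℕ.* t
      eq₂ = ℕ-Solver.solve-∀
      eq₃ : ∀ t i j → 20 ℕ.+ 4 ℕ.* t ℕ.+ (1 ℕ.+ j ℕ.* 2) ℕ.+ (6 ℕ.+ 3 ℕ.* i) ≡ 25 ℕ.+ 4 ℕ.* t ℕ.+ i ℕ.+ 2 ℕ.* ℕ.suc (i ℕ.+ j)
      eq₃ = ℕ-Solver.solve-∀
      eq₄ : ∀ t i → 25 ℕ.+ 4 ℕ.* t ℕ.+ i ℕ.+ 2 ℕ.* (2 ℕ.+ t) ≡ 29 ℕ.+ 6 ℕ.* t ℕ.+ i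
      eq₄ = ℕ-Solver.solve-∀
      odd : ∀ j → j ℕ.< 2 ℕ.+ t → Caught (20 ℕ.+ 4 ℕ.* t ℕ.+ (1 ℕ.+ j ℕ.* 2))
      -- The descent is in the index of the odd number, since the middle difference of `family₃`
      -- falls by 2: 21 + 4t + 2j = 23 + 6t - 2i when i + 1 + j = 2 + t.
      odd j j< = covered-descending {P = λ j → Caught (20 ℕ.+ 4 ℕ.* t ℕ.+ (1 ℕ.+ j ℕ.* 2))} {0} (2 ℕ.+ t) refl
        (λ i j i< i+j → at₃ i< (is-b (trans (eq₃ t i j) (trans (cong (λ z → 25 ℕ.+ 4 ℕ.* t ℕ.+ i ℕ.+ 2 ℕ.* z) i+j) (eq₄ t i))))) j ℕ.z≤n j<
      cases : ∀ (r : Fin 2) i → i ℕ.< 3 ℕ.+ t → Caught (20 ℕ.+ 4 ℕ.* t ℕ.+ (toℕ r ℕ.+ i ℕ.* 2))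
      cases zero i i< = at₁ (ℕ.m<n⇒m<1+n (ℕ.m<n⇒m<1+n i<)) (is-c (eq₁ t i))
      cases (suc zero) = below-suc odd (inj₂ (there (there (there (here (is-c (eq₂ t)))))))

    covered₅ : Covered Caught (26 ℕ.+ 6 ℕ.* t) (29 ℕ.+ 6 ℕ.* t)
    covered₅ = covered-trans (covered-single (at₁ (ℕ.m<n⇒m<1+n (ℕ.n<1+n (3 ℕ.+ t))) (is-c (eq₁ t))))
      -- The value 27 + 6t is q itself, the one multiple of q in the range.
      (covered-trans (covered-single (inj₁ (eq₂ t))) (covered-single (at₁ (ℕ.n<1+n (4 ℕ.+ t)) (is-c (eq₃ t)))))
      where
      eq₁ : ∀ t → 26 ℕ.+ 6 ℕ.* t ≡ 20 ℕ.+ 4 ℕ.* t ℕ.+ 2 ℕ.* (3 ℕ.+ t)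
      eq₁ = ℕ-Solver.solve-∀
      eq₂ : ∀ t → 27 ℕ.+ 6 ℕ.* t ≡ 2 ℕ.* (13 ℕ.+ t ℕ.* 3) ℕ.+ 1
      eq₂ = ℕ-Solver.solve-∀
      eq₃ : ∀ t → 28 ℕ.+ 6 ℕ.* t ≡ 20 ℕ.+ 4 ℕ.* t ℕ.+ 2 ℕ.* (4 ℕ.+ t)
      eq₃ = ℕ-Solver.solve-∀

    covered₆ : Covered Caught (29 ℕ.+ 6 ℕ.* t) (31 ℕ.+ 7 ℕ.* t)
    covered₆ = covered-by-offset (2 ℕ.+ t) (eq t) λ i i< → at₃ i< (is-c refl)
      where
      eq : ∀ t → 29 ℕ.+ 6 ℕ.* t ℕ.+ (2 ℕ.+ t) ≡ 31 ℕ.+ 7 ℕ.* t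
      eq = ℕ-Solver.solve-∀

    covered₇ : Covered Caught (31 ℕ.+ 7 ℕ.* t) (33 ℕ.+ 8 ℕ.* t)
    covered₇ = covered-trans (covered-single (inj₂ (there (there (there (there (here (is-b (eq₀ t)))))))))
      (covered-descending (1 ℕ.+ t) (eq t) λ i j i< i+j → at₂ i< (is-b
        (trans (eq₁ t i j) (trans (cong (λ z → 39 ℕ.+ 7 ℕ.* t ℕ.+ 2 ℕ.* i ℕ.+ z) i+j) (eq₂ t i)))))
      where
      eq₀ : ∀ t → 31 ℕ.+ 7 ℕ.* t ℕ.+ (12 ℕ.+ 3 ℕ.* t) ≡ 43 ℕ.+ 10 ℕ.* t
      eq₀ = ℕ-Solver.solve-∀
      eq : ∀ t → 32 ℕ.+ 7 ℕ.* t ℕ.+ (1 ℕ.+ t) ≡ 33 ℕ.+ 8 ℕ.* t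
      eq = ℕ-Solver.solve-∀
      eq₁ : ∀ t i j → 32 ℕ.+ 7 ℕ.* t ℕ.+ j ℕ.+ (8 ℕ.+ 3 ℕ.* i) ≡ 39 ℕ.+ 7 ℕ.* t ℕ.+ 2 ℕ.* i ℕ.+ ℕ.suc (i ℕ.+ j)
      eq₁ = ℕ-Solver.solve-∀
      eq₂ : ∀ t i → 39 ℕ.+ 7 ℕ.* t ℕ.+ 2 ℕ.* i ℕ.+ (1 ℕ.+ t) ≡ 40 ℕ.+ 8 ℕ.* t ℕ.+ 2 ℕ.* i
      eq₂ = ℕ-Solver.solve-∀

    covered₈ : Covered Caught (33 ℕ.+ 8 ℕ.* t) (40 ℕ.+ 8 ℕ.* t)
    covered₈ =
      covered-trans (covered-single (inj₂ (there (here (is-b (eq₃₃ t))))))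
      (covered-trans (covered-single (inj₂ (there (there (here (is-b (eq₃₄ t)))))))
      (covered-trans (covered-single (inj₂ (here (is-b (eq₃₅ t)))))
      (covered-trans (covered-single (inj₂ (there (here (is-c refl)))))
      (covered-trans (covered-single (inj₂ (here (is-c refl))))
      -- The fifth sporadic triple has c = 43 + 10t > v/2, so it contributes v - c = 38 + 8t.
      (covered-trans (covered-single (inj₂ (there (there (there (there (here (is--c (eq₃₈ t)))))))))
      (covered-single (inj₂ (there (there (here (is-c refl)))))))))))
      where
      eq₃₃ : ∀ t → 33 ℕ.+ 8 ℕ.* t ℕ.+ 3 ≡ 36 ℕ.+ 8 ℕ.* t
      eq₃₃ = ℕ-Solver.solve-∀
      eq₃₄ : ∀ t → 34 ℕ.+ 8 ℕ.* t ℕ.+ 5 ≡ 39 ℕ.+ 8 ℕ.* t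
      eq₃₄ = ℕ-Solver.solve-∀
      eq₃₅ : ∀ t → 35 ℕ.+ 8 ℕ.* t ℕ.+ 2 ≡ 37 ℕ.+ 8 ℕ.* t
      eq₃₅ = ℕ-Solver.solve-∀
      eq₃₈ : ∀ t → 38 ℕ.+ 8 ℕ.* t ℕ.+ (43 ℕ.+ 10 ℕ.* t) ≡ (2 ℕ.* (13 ℕ.+ t ℕ.* 3) ℕ.+ 1) ℕ.* 3
      eq₃₈ = ℕ-Solver.solve-∀

    -- The interval is symmetric under e ↦ v - e, where v = 81 + 18t. As v is odd, this exchanges
    -- parities: the even numbers are the values `c` of `family₂`, the odd ones their negatives.
    covered₉ : Covered Caught (40 ℕ.+ 8 ℕ.* t) (42 ℕ.+ 10 ℕ.* t)
    covered₉ = covered-period 2 (1 ℕ.+ t) (eq t) cases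
      where
      eq : ∀ t → 40 ℕ.+ 8 ℕ.* t ℕ.+ (1 ℕ.+ t) ℕ.* 2 ≡ 42 ℕ.+ 10 ℕ.* t
      eq = ℕ-Solver.solve-∀
      eq₁ : ∀ t i → 40 ℕ.+ 8 ℕ.* t ℕ.+ i ℕ.* 2 ≡ 40 ℕ.+ 8 ℕ.* t ℕ.+ 2 ℕ.* i
      eq₁ = ℕ-Solver.solve-∀
      eq₂ : ∀ t i j → 40 ℕ.+ 8 ℕ.* t ℕ.+ (1 ℕ.+ j ℕ.* 2) ℕ.+ (40 ℕ.+ 8 ℕ.* t ℕ.+ 2 ℕ.* i) ≡ 79 ℕ.+ 16 ℕ.* t ℕ.+ 2 ℕ.* ℕ.suc (i ℕ.+ j)
      eq₂ = ℕ-Solver.solve-∀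
      eq₃ : ∀ t → 79 ℕ.+ 16 ℕ.* t ℕ.+ 2 ℕ.* (1 ℕ.+ t) ≡ (2 ℕ.* (13 ℕ.+ t ℕ.* 3) ℕ.+ 1) ℕ.* 3
      eq₃ = ℕ-Solver.solve-∀
      cases : ∀ (r : Fin 2) i → i ℕ.< 1 ℕ.+ t → Caught (40 ℕ.+ 8 ℕ.* t ℕ.+ (toℕ r ℕ.+ i ℕ.* 2))
      cases zero i i< = at₂ i< (is-c (eq₁ t i))
      cases (suc zero) j j< = covered-descending {P = λ j → Caught (40 ℕ.+ 8 ℕ.* t ℕ.+ (1 ℕ.+ j ℕ.* 2))} {0} (1 ℕ.+ t) refl
        (λ i j i< i+j → at₂ i< (is--c (trans (eq₂ t i j) (trans (cong (λ z → 79 ℕ.+ 16 ℕ.* t ℕ.+ 2 ℕ.* z) i+j) (eq₃ t))))) j ℕ.z≤n j<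

    covered : Covered Caught 1 (42 ℕ.+ 10 ℕ.* t)
    covered = covered-trans covered₁ (covered-trans covered₂ (covered-trans covered₃ (covered-trans covered₄
      (covered-trans covered₅ (covered-trans covered₆ (covered-trans covered₇ (covered-trans covered₈ covered₉)))))))

    peltesohnBaseCycles : ∃ (CyclicSystem.BaseCycles n 3)
    peltesohnBaseCycles = triangles-baseCycles triples length-triples
      -- The symmetric last interval reaches beyond (v - 1)/2 = 40 + 9t, where the requirement ends.
      λ e 1≤e e< → covered e 1≤e (ℕ.≤-trans e< (subst₂ ℕ._≤_ (eq₁ t) (eq₂ t) (ℕ.m≤m+n (41 ℕ.+ 9 ℕ.* t) (1 ℕ.+ t))))
      where
      eq₁ : ∀ t → 41 ℕ.+ 9 ℕ.* t ≡ 3 ℕ.* (13 ℕ.+ t ℕ.* 3) ℕ.+ 2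
      eq₁ = ℕ-Solver.solve-∀
      eq₂ : ∀ t → 41 ℕ.+ 9 ℕ.* t ℕ.+ (1 ℕ.+ t) ≡ 42 ℕ.+ 10 ℕ.* t
      eq₂ = ℕ-Solver.solve-∀

  triangles-by-search : ∀ n .{{_ : NonZero (2 ℕ.* n ℕ.+ 1)}} (L : List (ℕ × ℕ)) → length L ≡ n →
    {True (all? λ (e : Fin (3 ℕ.* n ℕ.+ 2)) →
      (toℕ e ℕ.≟ 0) ⊎-dec (toℕ e ℕ.≟ 2 ℕ.* n ℕ.+ 1) ⊎-dec Any.any? (Triangles.catches? n (toℕ e)) L)} →
    ∃ (CyclicSystem.BaseCycles n 3)
  triangles-by-search n L length≡ {t} = triangles-baseCycles L length≡ λ e 1≤e e< →
    subst (λ e → e ≡ 2 ℕ.* n ℕ.+ 1 ⊎ Any (Catches e) L) (toℕ-fromℕ< e<)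
      ([ (λ e≡0 → contradiction (trans (sym (toℕ-fromℕ< e<)) e≡0) (ℕ.>⇒≢ 1≤e)) , id ]′ (toWitness t (fromℕ< e<)))
    where open Triangles n

  by-thirds : ∀ n → ∃ λ s → n ≡ s ℕ.* 3 ⊎ n ≡ 1 ℕ.+ s ℕ.* 3 ⊎ n ≡ 2 ℕ.+ s ℕ.* 3
  by-thirds ℕ.zero = 0 , inj₁ refl
  by-thirds (ℕ.suc n) = go (by-thirds n)
    where
    go : _ → _
    go (s , inj₁ p) = s , inj₂ (inj₁ (cong ℕ.suc p))
    go (s , inj₂ (inj₁ p)) = s , inj₂ (inj₂ (cong ℕ.suc p))
    go (s , inj₂ (inj₂ p)) = ℕ.suc s , inj₁ (cong ℕ.suc p)

  baseCycles₃ : ∀ n .{{_ : NonZero (2 ℕ.* n ℕ.+ 1)}} → 3 ℕ.≤ n →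
    n ℕ.% 4 ≡ 0 ⊎ n ℕ.% 4 ≡ 3 → ∃ (CyclicSystem.BaseCycles n 3)
  baseCycles₃ n 3≤n n%4 = go (by-thirds n)
    where
    bose : ∀ {q} → + (2 ℕ.* n ℕ.+ 1) ≡ q → + 3 ∣ q * q - 1ℤ → ∃ (CyclicSystem.BaseCycles n 3)
    bose refl 3∣q²-1 = _ , Triangles.Bose.boseBaseCycles n 3∣q²-1
    go : _ → ∃ (CyclicSystem.BaseCycles n 3)
    go (s , inj₁ refl) = bose (trans (cong +_ (eq s)) (cong (λ z → 1ℤ + z) (ℤ.pos-* 6 s)))
      (divides (+ 12 * + s * + s + + 4 * + s) (eq′ (+ s)))
      where
      eq : ∀ s → 2 ℕ.* (s ℕ.* 3) ℕ.+ 1 ≡ 1 ℕ.+ 6 ℕ.* s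
      eq = ℕ-Solver.solve-∀
      eq′ : ∀ s → (1ℤ + + 6 * s) * (1ℤ + + 6 * s) - 1ℤ ≡ (+ 12 * s * s + + 4 * s) * + 3
      eq′ = solve-∀
    go (s , inj₂ (inj₂ refl)) = bose (trans (cong +_ (eq s)) (cong (λ z → + 5 + z) (ℤ.pos-* 6 s)))
      (divides (+ 12 * + s * + s + + 20 * + s + + 8) (eq′ (+ s)))
      where
      eq : ∀ s → 2 ℕ.* (2 ℕ.+ s ℕ.* 3) ℕ.+ 1 ≡ 5 ℕ.+ 6 ℕ.* s
      eq = ℕ-Solver.solve-∀
      eq′ : ∀ s → (+ 5 + + 6 * s) * (+ 5 + + 6 * s) - 1ℤ ≡ (+ 12 * s * s + + 20 * s + + 8) * + 3
      eq′ = solve-∀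
    -- Here v = 9, and no choice of signs makes ±1 ± 2 ± 4 divisible by 9.
    go (0 , inj₂ (inj₁ refl)) = contradiction 3≤n (λ { (ℕ.s≤s ()) })
    -- The orders 27 and 45 lie below the range of the families; their triples are verified by
    -- evaluation.
    go (1 , inj₂ (inj₁ refl)) = triangles-by-search 4 ((1 , 3) ∷ (4 , 11) ∷ (5 , 15) ∷ (6 , 14) ∷ []) refl
    go (2 , inj₂ (inj₁ refl)) = triangles-by-search 7
      ((1 , 3) ∷ (4 , 9) ∷ (6 , 17) ∷ (7 , 23) ∷ (8 , 26) ∷ (10 , 24) ∷ (12 , 25) ∷ []) refl
    -- The congruence rules out n = 10, which is 2 modulo 4.
    go (3 , inj₂ (inj₁ refl)) = contradiction n%4 (λ { (inj₁ ()) ; (inj₂ ()) })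
    go (ℕ.suc (ℕ.suc (ℕ.suc (ℕ.suc t))) , inj₂ (inj₁ refl)) = Peltesohn.peltesohnBaseCycles t

  -- Assembly of the cases.

  OrthogonalPair : ℕ → ℕ → Set₁
  OrthogonalPair n k = ∃₂ λ 𝒟 𝒟′ →
    IsCycleDecomposition k K[ 2 ℕ.* n ℕ.+ 1 × k ] 𝒟 × IsCyclic 𝒟 ×
    IsCycleDecomposition k K[ 2 ℕ.* n ℕ.+ 1 × k ] 𝒟′ × IsCyclic 𝒟′ ×
    Orthogonal 𝒟 𝒟′

  orthogonalPair : ∀ n k .{{_ : NonZero (2 ℕ.* n ℕ.+ 1)}} .{{_ : NonZero k}} → 3 ℕ.≤ k →
    ∃ (CyclicSystem.BaseCycles n k) → OrthogonalPair n k
  orthogonalPair n k 3≤k (_ , base) = Develop.orthogonal-decompositions n k 3≤k base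

  orthogonalPairs : ∀ n k → 1 ℕ.≤ n → 1 ℕ.≤ k → n ℕ.≥ k →
      ( ((k ≡ 3 ⊎ k ≡ 7 ⊎ k ≡ 9) × (n ℕ.% 4 ≡ 0 ⊎ n ℕ.% 4 ≡ 3))
      ⊎ (k ≡ 5 × n ℕ.% 4 ≡ 3)
      ⊎ (k ≡ 4 ⊎ k ≡ 8)
      ⊎ (k ≡ 6 × 2 ℕ.∣ n) ) → OrthogonalPair n k
  orthogonalPairs n k _ _ n≥k = cases
    where
    instance
      q-nonZero : NonZero (2 ℕ.* n ℕ.+ 1)
      q-nonZero = odd-nonZero n
    three : ∀ {k} → 3 ℕ.≤ 3 ℕ.+ k
    three = ℕ.s≤s (ℕ.s≤s (ℕ.s≤s ℕ.z≤n))
    cases : _ → OrthogonalPair n k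
    cases (inj₁ (inj₁ refl , n%4)) = orthogonalPair n 3 three (baseCycles₃ n n≥k n%4)
    cases (inj₁ (inj₂ (inj₁ refl) , _)) = orthogonalPair n 7 three (baseCycles₇ n)
    cases (inj₁ (inj₂ (inj₂ refl) , _)) = orthogonalPair n 9 three (baseCycles₉ n)
    cases (inj₂ (inj₁ (refl , _))) = orthogonalPair n 5 three (baseCycles₅ n)
    cases (inj₂ (inj₂ (inj₁ (inj₁ refl)))) = orthogonalPair n 4 three (baseCycles₄ n)
    cases (inj₂ (inj₂ (inj₁ (inj₂ refl)))) = orthogonalPair n 8 three (baseCycles₈ n)
    cases (inj₂ (inj₂ (inj₂ (refl , ℕ.divides m refl)))) =
      orthogonalPair n 6 three (PairedClasses.base m , PairedClasses.baseCycles m)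

open import Data.Nat.Base using (ℕ; _+_; _*_; _≤_; _≥_)
open import Data.Nat.DivMod using (_%_)
open import Data.Nat.Divisibility using (_∣_)
open import Data.Product using (_×_; ∃₂)
open import Data.Sum using (_⊎_)
open import Relation.Binary.PropositionalEquality using (_≡_)

proposition6p2 : ∀ (n k : ℕ) → 1 ≤ n → 1 ≤ k → n ≥ k →
    ( ((k ≡ 3 ⊎ k ≡ 7 ⊎ k ≡ 9) × (n % 4 ≡ 0 ⊎ n % 4 ≡ 3))
    ⊎ (k ≡ 5 × n % 4 ≡ 3)
    ⊎ (k ≡ 4 ⊎ k ≡ 8)
    ⊎ (k ≡ 6 × 2 ∣ n) ) →
    ∃₂ λ 𝒟 𝒟′ →
    IsCycleDecomposition k K[ 2 * n + 1 × k ] 𝒟 × IsCyclic 𝒟 ×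
    IsCycleDecomposition k K[ 2 * n + 1 × k ] 𝒟′ × IsCyclic 𝒟′ ×
    Orthogonal 𝒟 𝒟′
proposition6p2 = CyclicDecompositions.orthogonalPairs
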